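{- Consider the identities, for a binary function symbol $f$ and a constant $0$: $\mathsf{A}=\{f(x,f(y,z))\approx f(f(x,y),z)\}$, $\mathsf{C}=\{f(x,y)\approx f(y,x)\}$, $\mathsf{I}=\{f(x,x)\approx x\}$, $\mathsf{U}=\{f(x,0)\approx x\}$. Each of the equational theories $\mathsf{AI}=\mathsf{A}\cup\mathsf{I}$ (signature $\{f\}$), $\mathsf{ACI}=\mathsf{A}\cup\mathsf{C}\cup\mathsf{I}$ (signature $\{f\}$), and $\mathsf{ACUI}=\mathsf{A}\cup\mathsf{C}\cup\mathsf{U}\cup\mathsf{I}$ (signature $\{f,0\}$) has unrestricted unification type infinitary for elementary unification.
   Context: Let $\Sigma$ be a finite signature, $V$ a countably infinite set of variables, and $T(\Sigma,V)$ the set of terms. An equational theory $E$ is a set of identities between terms (implicitly universally quantified), and $\approx_E$ is the congruence relation on $T(\Sigma,V)$ it induces ($s\approx_E t$ iff $s\approx t$ holds in all models of $E$). A substitution is a map $\sigma:V\to T(\Sigma,V)$ with finite domain $\{x\in V\mid\sigma(x)\neq x\}$, extended homomorphically to terms. The unrestricted instantiation preorder $\leq_E^V$ is defined by: $\sigma\leq_E^V\tau$ iff there is a substitution $\lambda$ with $\lambda(\sigma(x))\approx_E\tau(x)$ for all $x\in V$. An $E$-unification problem is a finite set $\Gamma=\{s_1\approx_E^? t_1,\ldots,s_n\approx_E^? t_n\}$ of equations between terms in $T(\Sigma,V)$; elementary unification means that $\Sigma$ contains only function symbols occurring in $E$. An $E$-unifier of $\Gamma$ is a substitution $\sigma$ with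 $\sigma(s_i)\approx_E\sigma(t_i)$ for all $i$; $\Gamma$ is solvable if it has an $E$-unifier. A set $S$ of $E$-unifiers of $\Gamma$ is complete w.r.t. $\leq_E^V$ if for every $E$-unifier $\theta$ of $\Gamma$ there is $\sigma\in S$ with $\sigma\leq_E^V\theta$; it is minimal if no two distinct elements of $S$ are comparable w.r.t. $\leq_E^V$. Minimal complete sets of the same problem all have the same cardinality. The unrestricted unification type of a solvable $\Gamma$ is: unitary if $\Gamma$ has a minimal complete set (w.r.t. $\leq_E^V$) of cardinality one; finitary if it has a finite minimal complete set of cardinality greater than one; infinitary if it has an infinite minimal complete set; zero if it has no minimal complete set. Types are ordered by zero $>$ infinitary $>$ finitary $>$ unitary, and the unrestricted unification type of $E$ is the largest (worst) unrestricted type of any solvable $E$-unification problem. -}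

module Defs where

open import Data.Fin.Base using (Fin; zero; suc)
open import Data.List.Base using (List)
open import Data.List.Membership.Propositional using (_∈_)
open import Data.List.Relation.Unary.All using (All)
open import Data.Nat.Base as ℕ using (ℕ)
open import Data.Product.Base using (∃; ∃-syntax; _×_; _,_; proj₁)
open import Data.Sum.Base using (_⊎_)
open import Data.Vec.Base using (Vec; []; _∷_)
open import Data.Vec.Relation.Binary.Pointwise.Inductive using (Pointwise; []; _∷_)
open import Data.Vec.Relation.Unary.Any as VecAny using ()
open import Function.Bundles using (Bijection)
open import Level as Level using (0ℓ; _⊔_)
open import Relation.Binary.Bundles using (Setoid)
import Relation.Binary.Construct.On as On
open import Relation.Binary.PropositionalEquality as ≡ using (_≡_; _≢_)
open import Relation.Nullary.Negation using (¬_)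
open import Relation.Unary using (Pred; _∪_; ｛_｝; _⊆_)

record Signature : Set where
  field
    size  : ℕ
    arity : Fin size → ℕ

  Symbol : Set
  Symbol = Fin size

open Signature public using (Symbol; arity)

-- The fixed countably infinite set of variables.
V : Set
V = ℕ

data Term (Sg : Signature) : Set where
  var : V → Term Sg
  op  : (g : Symbol Sg) → Vec (Term Sg) (arity Sg g) → Term Sg

Map : Signature → Set
Map Sg = V → Term Sg

Theory : Signature → Set₁
Theory Sg = Pred (Term Sg × Term Sg) 0ℓ

module _ {Sg : Signature} where

  infixl 8 _[_] _[_]*

  -- Homomorphic extension of a map on variables.
  mutual
    _[_] : Term Sg → Map Sg → Term Sg
    var x   [ σ ] = σ x
    op g ts [ σ ] = op g (ts [ σ ]*)

    _[_]* : ∀ {n} → Vec (Term Sg) n → Map Sg → Vec (Term Sg) n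
    []       [ σ ]* = []
    (t ∷ ts) [ σ ]* = t [ σ ] ∷ ts [ σ ]*

  infix 4 _⊢_≈_

  -- The congruence induced by E: the least congruence containing all instances
  -- of identities of E.  It coincides with validity in all models of E, see
  -- `soundness` and `completeness` below.
  data _⊢_≈_ (E : Theory Sg) : Term Sg → Term Sg → Set where
    instance-of : ∀ {s t} → E (s , t) → (σ : Map Sg) → E ⊢ s [ σ ] ≈ t [ σ ]
    reflexive   : ∀ {t} → E ⊢ t ≈ t
    symmetric   : ∀ {s t} → E ⊢ s ≈ t → E ⊢ t ≈ s
    transitive  : ∀ {s t u} → E ⊢ s ≈ t → E ⊢ t ≈ u → E ⊢ s ≈ u
    congruent   : ∀ g {ss ts} → Pointwise (E ⊢_≈_) ss ts → E ⊢ op g ss ≈ op g ts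

-- Models, with equality interpreted by a setoid.

record Algebra (Sg : Signature) c ℓ : Set (Level.suc (c ⊔ ℓ)) where
  field
    carrier : Setoid c ℓ
  open Setoid carrier public
  field
    apply : (g : Symbol Sg) → Vec Carrier (arity Sg g) → Carrier
    apply-cong : ∀ g {as bs} → Pointwise _≈_ as bs → apply g as ≈ apply g bs

  mutual
    eval : (V → Carrier) → Term Sg → Carrier
    eval ρ (var x)   = ρ x
    eval ρ (op g ts) = apply g (eval* ρ ts)

    eval* : (V → Carrier) → ∀ {n} → Vec (Term Sg) n → Vec Carrier n
    eval* ρ []       = []
    eval* ρ (t ∷ ts) = eval ρ t ∷ eval* ρ ts

  _⊨_ : Term Sg → Term Sg → Set (c ⊔ ℓ)
  s ⊨ t = ∀ ρ → eval ρ s ≈ eval ρ t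

  IsModelOf : Theory Sg → Set (c ⊔ ℓ)
  IsModelOf E = ∀ {s t} → E (s , t) → s ⊨ t

module _ {Sg : Signature} (E : Theory Sg) where

  module _ {c ℓ} (M : Algebra Sg c ℓ) where
    open Algebra M

    mutual
      eval-[] : ∀ ρ σ t → eval ρ (t [ σ ]) ≈ eval (λ x → eval ρ (σ x)) t
      eval-[] ρ σ (var x)   = refl
      eval-[] ρ σ (op g ts) = apply-cong g (eval-[]* ρ σ ts)

      eval-[]* : ∀ ρ σ {n} (ts : Vec (Term Sg) n) →
                 Pointwise _≈_ (eval* ρ (ts [ σ ]*)) (eval* (λ x → eval ρ (σ x)) ts)
      eval-[]* ρ σ []       = []
      eval-[]* ρ σ (t ∷ ts) = eval-[] ρ σ t ∷ eval-[]* ρ σ ts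

    module _ (model : IsModelOf E) where
      mutual
        soundness : ∀ {s t} → E ⊢ s ≈ t → s ⊨ t
        soundness (instance-of {s} {t} e σ) ρ =
          trans (eval-[] ρ σ s) (trans (model e _) (sym (eval-[] ρ σ t)))
        soundness reflexive        ρ = refl
        soundness (symmetric p)    ρ = sym (soundness p ρ)
        soundness (transitive p q) ρ = trans (soundness p ρ) (soundness q ρ)
        soundness (congruent g ps) ρ = apply-cong g (soundness* ps ρ)

        soundness* : ∀ {n} {ss ts : Vec (Term Sg) n} → Pointwise (E ⊢_≈_) ss ts →
                     ∀ ρ → Pointwise _≈_ (eval* ρ ss) (eval* ρ ts)
        soundness* []       ρ = []
        soundness* (p ∷ ps) ρ = soundness p ρ ∷ soundness* ps ρ

  termAlgebra : Algebra Sg 0ℓ 0ℓ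
  termAlgebra = record
    { carrier = record
      { Carrier = Term Sg
      ; _≈_ = E ⊢_≈_
      ; isEquivalence = record { refl = reflexive ; sym = symmetric ; trans = transitive }
      }
    ; apply = op
    ; apply-cong = congruent
    }

  private
    module T = Algebra termAlgebra

    mutual
      eval-term : ∀ σ t → T.eval σ t ≡ t [ σ ]
      eval-term σ (var x)   = ≡.refl
      eval-term σ (op g ts) = ≡.cong (op g) (eval-term* σ ts)

      eval-term* : ∀ σ {n} (ts : Vec (Term Sg) n) → T.eval* σ ts ≡ ts [ σ ]*
      eval-term* σ []       = ≡.refl
      eval-term* σ (t ∷ ts) = ≡.cong₂ _∷_ (eval-term σ t) (eval-term* σ ts)

    mutual
      [var] : (t : Term Sg) → t [ var ] ≡ t
      [var] (var x)   = ≡.refl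
      [var] (op g ts) = ≡.cong (op g) ([var]* ts)

      [var]* : ∀ {n} (ts : Vec (Term Sg) n) → ts [ var ]* ≡ ts
      [var]* []       = ≡.refl
      [var]* (t ∷ ts) = ≡.cong₂ _∷_ ([var] t) ([var]* ts)

  completeness : ∀ {s t} →
    ((M : Algebra Sg 0ℓ 0ℓ) → Algebra.IsModelOf M E → Algebra._⊨_ M s t) → E ⊢ s ≈ t
  completeness {s} {t} valid = ≡.subst₂ (E ⊢_≈_)
    (≡.trans (eval-term var s) ([var] s)) (≡.trans (eval-term var t) ([var] t))
    (valid termAlgebra termIsModel var)
    where
    termIsModel : T.IsModelOf E
    termIsModel {u} {v} e σ = ≡.subst₂ (E ⊢_≈_)
      (≡.sym (eval-term σ u)) (≡.sym (eval-term σ v)) (instance-of e σ)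

record Substitution (Sg : Signature) : Set where
  field
    ⟦_⟧           : Map Sg
    domain        : List V
    domain-covers : ∀ x → ⟦_⟧ x ≢ var x → x ∈ domain

open Substitution public using (⟦_⟧)

-- Two substitutions are the same when they are equal as maps.
substitutionSetoid : Signature → Setoid 0ℓ 0ℓ
substitutionSetoid Sg = On.setoid (≡._→-setoid_ V (Term Sg)) ⟦_⟧

infix 4 _≐_
_≐_ : ∀ {Sg} → Substitution Sg → Substitution Sg → Set
_≐_ {Sg} = Setoid._≈_ (substitutionSetoid Sg)

HasCardinality : ∀ {Sg} → Pred (Substitution Sg) 0ℓ → ℕ → Set
HasCardinality {Sg} S n =
  Bijection (≡.setoid (Fin n)) (On.setoid (substitutionSetoid Sg) (proj₁ {B = S}))

Infinite : ∀ {Sg} → Pred (Substitution Sg) 0ℓ → Set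
Infinite S = ¬ (∃[ n ] HasCardinality S n)

Problem : Signature → Set
Problem Sg = List (Term Sg × Term Sg)

data UnificationType : Set where
  unitary finitary infinitary zero : UnificationType

badness : UnificationType → ℕ
badness unitary    = 0
badness finitary   = 1
badness infinitary = 2
badness zero       = 3

infix 4 _≤ᵗ_
_≤ᵗ_ : UnificationType → UnificationType → Set
t ≤ᵗ t′ = badness t ℕ.≤ badness t′

module _ {Sg : Signature} (E : Theory Sg) where

  infix 4 _≼_

  -- The unrestricted instantiation preorder: all variables are compared, and the
  -- witness is itself a substitution, hence of finite domain.
  _≼_ : Substitution Sg → Substitution Sg → Set
  σ ≼ τ = ∃[ λ′ ] ∀ x → E ⊢ ⟦ σ ⟧ x [ ⟦ λ′ ⟧ ] ≈ ⟦ τ ⟧ x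

  Unifier : Problem Sg → Pred (Substitution Sg) 0ℓ
  Unifier Γ σ = All (λ (s , t) → E ⊢ s [ ⟦ σ ⟧ ] ≈ t [ ⟦ σ ⟧ ]) Γ

  Solvable : Problem Sg → Set
  Solvable Γ = ∃[ σ ] Unifier Γ σ

  record MinimalComplete (Γ : Problem Sg) (S : Pred (Substitution Sg) 0ℓ) : Set where
    field
      unifiers : S ⊆ Unifier Γ
      complete : ∀ θ → Unifier Γ θ → ∃[ σ ] S σ × σ ≼ θ
      minimal  : ∀ σ τ → S σ → S τ → ¬ (σ ≐ τ) → ¬ (σ ≼ τ)

  ProblemHasType : Problem Sg → UnificationType → Set₁
  ProblemHasType Γ unitary    = ∃[ S ] MinimalComplete Γ S × HasCardinality S 1
  ProblemHasType Γ finitary   = ∃[ S ] MinimalComplete Γ S × ∃[ n ] 1 ℕ.< n × HasCardinality S n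
  ProblemHasType Γ infinitary = ∃[ S ] MinimalComplete Γ S × Infinite S
  ProblemHasType Γ zero       = ¬ (∃[ S ] MinimalComplete Γ S)

  record HasUnrestrictedType (t : UnificationType) : Set₁ where
    field
      attained : ∃[ Γ ] Solvable Γ × ProblemHasType Γ t
      worst    : ∀ Γ → Solvable Γ → ∀ t′ → ProblemHasType Γ t′ → t′ ≤ᵗ t

data _OccursIn_ {Sg : Signature} (g : Symbol Sg) : Term Sg → Set where
  root   : ∀ {ts} → g OccursIn op g ts
  inside : ∀ {h ts} → VecAny.Any (g OccursIn_) ts → g OccursIn op h ts

-- The signature contains only symbols occurring in E.
Elementary : ∀ {Sg} → Theory Sg → Set
Elementary {Sg} E =
  ∀ (g : Symbol Sg) → ∃[ s ] ∃[ t ] E (s , t) × (g OccursIn s ⊎ g OccursIn t)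

HasElementaryUnrestrictedType : ∀ {Sg} → Theory Sg → UnificationType → Set₁
HasElementaryUnrestrictedType E t = Elementary E × HasUnrestrictedType E t

module Identities {Sg : Signature} (f : Term Sg → Term Sg → Term Sg) where
  private
    x y z : Term Sg
    x = var 0
    y = var 1
    z = var 2

  A C I : Theory Sg
  A = ｛ f x (f y z) , f (f x y) z ｝
  C = ｛ f x y , f y x ｝
  I = ｛ f x x , x ｝

  U : Term Sg → Theory Sg
  U 𝟘 = ｛ f x 𝟘 , x ｝

sig-f : Signature
sig-f = record { size = 1 ; arity = λ _ → 2 }

sig-f0 : Signature
sig-f0 = record { size = 2 ; arity = λ { zero → 2 ; (suc _) → 0 } }

module _ where
  open Identities {sig-f} (λ s t → op zero (s ∷ t ∷ []))

  AI ACI : Theory sig-f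
  AI  = A ∪ I
  ACI = A ∪ C ∪ I

module _ where
  open Identities {sig-f0} (λ s t → op zero (s ∷ t ∷ []))

  ACUI : Theory sig-f0
  ACUI = A ∪ C ∪ U (op (suc zero) []) ∪ I

{-# OPTIONS --safe #-}

-- Equivalent terms have the same variables in all three theories, the word problem is decidable (for AI by
-- Green and Rees: a word is determined by its longest prefix and suffix missing a letter and the letters
-- next to them), and terms over finitely many variables fall into finitely many classes.  Let V_k
-- consist of the first k variables and say that a substitution lives on V_k if it maps V_k to terms over V_k
-- and fixes all other variables.
--
-- If σ ≼ θ via λ and θ lives on V_k, then each x outside V_k equals λ(σ(x)), so σ(x) contains a variable that
-- λ maps to x alone.  These variables do not occur in σ(V_k), and counting leaves at most k variables for
-- σ(V_k).  Renaming them into V_k and fixing all other variables yields σ′ ≼ σ living on V_k.  Hence minimal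
-- unifiers below θ can be found among finitely many candidates, and one representative of each class of
-- minimal unifiers forms a minimal complete set.
--
-- These sets can be infinite: for xyx ≈ xzx and every k ≥ 3 there is a unifier whose values on V_k involve
-- k + 1 letters that would have to come from distinct variables of any more general unifier.  So no unifier
-- living on V_k lies below it, whereas any finite set of substitutions lives on a common V_k.

module Submission where

open import Defs
open import Algebra.Bundles using (IdempotentMonoid)
open import Algebra.Construct.Add.Identity using (isMonoid)
open import Data.Empty using (⊥; ⊥-elim)
open import Data.Fin.Base using (Fin; zero; suc; toℕ; fromℕ<)
open import Data.Fin.Properties using (injective⇒≤; toℕ-injective; toℕ<n; fromℕ<-toℕ; fromℕ<-injective)
open import Data.List.Base as List using (List; []; _∷_; _++_; _∷ʳ_; reverse; length; filter; upTo; cartesianProductWith; concatMap; deduplicate; lookup; tabulate)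
open import Data.List.Membership.Propositional using (_∈_; _∉_; lose; find)
open import Data.List.Membership.Propositional.Properties using (∈-++⁺ˡ; ∈-++⁺ʳ; ∈-++⁻; ∈-∃++; ∈-filter⁺; ∈-filter⁻; ∈-cartesianProductWith⁺; ∈-upTo⁺; ∈-upTo⁻; ∈-concatMap⁺; ∈-concatMap⁻; ∈-deduplicate⁺; ∈-deduplicate⁻; ∈-lookup; ∈-tabulate⁻; ∈-map⁺)
open import Data.List.Properties using (++-assoc; ++-identityʳ; ++-monoid; reverse-++; reverse-involutive; filter-notAll; length-++; length-upTo; length-tabulate)
open import Data.List.Relation.Binary.Subset.Propositional using (_⊆_)
open import Data.List.Relation.Binary.Subset.Propositional.Properties using (++⁺; ∷⁺ʳ)
open import Data.List.Relation.Unary.All as All using (All; []; _∷_)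
open import Data.List.Relation.Unary.Any as Any using (here; there; Any; index)
open import Data.List.Relation.Unary.Any.Properties using (reverse⁺; reverse⁻; lookup-index)
open import Data.List.Relation.Unary.First as First using (First; _∷_) renaming ([_] to found)
open import Data.List.Relation.Unary.First.Properties using (⁺++)
open import Data.List.Relation.Unary.Unique.Propositional using (Unique; []; _∷_)
open import Data.List.Relation.Unary.Unique.Propositional.Properties as Unique using ()
open import Data.List.Reverse using (Reverse; reverseView; []; _∶_∶ʳ_)
open import Data.Maybe.Base using (just; nothing)
open import Data.Nat.Base using (ℕ; zero; suc; _≤_; _<_; s≤s; z≤n; _+_; _⊔_)
open import Data.Nat.Properties using (_≟_; ≤-refl; ≤-pred; <-≤-trans; _<?_; ≤-trans; ≤-reflexive; ≤-<-trans; m≤m+n; m≤n+m; m≤m⊔n; m≤n⊔m; ≮⇒≥; <⇒≱; +-cancelˡ-≡; +-cancelʳ-≤; +-monoʳ-<; allUpTo?; 1+n≰n; n≤1+n; ≤∧≢⇒<; +-comm)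
open import Data.Product.Base using (∃; ∃-syntax; _×_; _,_; proj₁; proj₂)
open import Data.Sum.Base using (_⊎_; inj₁; inj₂; [_,_]′)
open import Data.Unit.Base using (⊤; tt)
open import Data.Vec.Base using (Vec; []; _∷_)
open import Data.Vec.Relation.Binary.Pointwise.Inductive using (Pointwise; []; _∷_)
open import Data.Vec.Relation.Unary.Any as VecAny using ()
open import Function.Base using (_∘_; id)
open import Function.Bundles using (Bijection)
open import Level using (0ℓ)
open import Relation.Binary.Construct.Add.Point.Equality using (∙≈∙) renaming ([_] to [_]≈)
open import Relation.Binary.PropositionalEquality using (_≡_; _≢_; refl; sym; trans; cong; cong₂; subst; subst₂)
open import Relation.Binary.Structures using (IsEquivalence)
open import Relation.Nullary.Decidable using (Dec; yes; no; map′; _×-dec_; ¬?; True; False; toWitness; toWitnessFalse)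
open import Relation.Nullary.Negation using (¬_; contradiction)
open import Relation.Unary using (Pred; Decidable)
open import Tactic.MonoidSolver using (solve)
open import Data.List.Membership.DecPropositional _≟_ using (_∈?_)
open import Data.List.Relation.Unary.Unique.DecPropositional.Properties _≟_ using (deduplicate-!)

-- The word problem of idempotent monoids

Word : Set
Word = List V

infix 4 _≈ʷ_

-- The quotient is the free idempotent monoid over `V`; keeping the empty word lets one relation
-- serve theories with and without a unit.
data _≈ʷ_ : Word → Word → Set where
  idem  : ∀ u → u ++ u ≈ʷ u
  reflʷ : ∀ {u} → u ≈ʷ u
  symʷ  : ∀ {u v} → u ≈ʷ v → v ≈ʷ u
  transʷ : ∀ {u v w} → u ≈ʷ v → v ≈ʷ w → u ≈ʷ w
  ++-cong : ∀ {u u′ v v′} → u ≈ʷ u′ → v ≈ʷ v′ → u ++ v ≈ʷ u′ ++ v′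

≡⇒≈ʷ : ∀ {u v} → u ≡ v → u ≈ʷ v
≡⇒≈ʷ refl = reflʷ

module ≈ʷ-Reasoning where
  infix  3 _∎ʷ
  infixr 2 step-≈ʷ step-≡ʷ

  step-≈ʷ : ∀ u {v w} → v ≈ʷ w → u ≈ʷ v → u ≈ʷ w
  step-≈ʷ _ q p = transʷ p q

  step-≡ʷ : ∀ u {v w} → v ≈ʷ w → u ≡ v → u ≈ʷ w
  step-≡ʷ _ q refl = q

  syntax step-≈ʷ u q p = u ≈⟨ p ⟩ q
  syntax step-≡ʷ u q p = u ≡⟨ p ⟩ q

  _∎ʷ : ∀ u → u ≈ʷ u
  _ ∎ʷ = reflʷ

open ≈ʷ-Reasoning

++-congˡ : ∀ u {v w} → v ≈ʷ w → u ++ v ≈ʷ u ++ w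
++-congˡ u = ++-cong (reflʷ {u})

++-congʳ : ∀ w {u v} → u ≈ʷ v → u ++ w ≈ʷ v ++ w
++-congʳ w p = ++-cong p (reflʷ {w})

≈ʷ⇒⊆×⊇ : ∀ {u v} → u ≈ʷ v → u ⊆ v × v ⊆ u
≈ʷ⇒⊆×⊇ (idem u) = ([ id , id ]′ ∘ ∈-++⁻ u) , ∈-++⁺ˡ
≈ʷ⇒⊆×⊇ reflʷ = id , id
≈ʷ⇒⊆×⊇ (symʷ p) = let a , b = ≈ʷ⇒⊆×⊇ p in b , a
≈ʷ⇒⊆×⊇ (transʷ p q) = let a , b = ≈ʷ⇒⊆×⊇ p ; c , d = ≈ʷ⇒⊆×⊇ q in c ∘ a , b ∘ d
≈ʷ⇒⊆×⊇ (++-cong p q) = let a , b = ≈ʷ⇒⊆×⊇ p ; c , d = ≈ʷ⇒⊆×⊇ q in ++⁺ a c , ++⁺ b d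

≈ʷ⇒⊆ : ∀ {u v} → u ≈ʷ v → u ⊆ v
≈ʷ⇒⊆ = proj₁ ∘ ≈ʷ⇒⊆×⊇

infix 4 _absorbs_
-- In an idempotent monoid this says that `a` lies in the two-sided ideal generated by `u`.
_absorbs_ : Word → Word → Set
a absorbs u = a ++ u ++ a ≈ʷ a

-- Written without `++`: idempotence of `by` gives `abya ≈ʷ a`, hence
-- `aba ≈ʷ ab(abya) ≈ʷ abya ≈ʷ a`.
absorbs-factor : ∀ x b y → (x ++ b ++ y) absorbs b
absorbs-factor x b y =
  a ++ b ++ a                      ≈⟨ ++-congˡ a (++-congˡ b (symʷ split)) ⟩
  a ++ b ++ (a ++ b) ++ (y ++ a)   ≡⟨ solve (++-monoid V) ⟩
  ((a ++ b) ++ (a ++ b)) ++ y ++ a ≈⟨ ++-congʳ (y ++ a) (idem (a ++ b)) ⟩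
  (a ++ b) ++ (y ++ a)             ≈⟨ split ⟩
  a                                ∎ʷ
  where
  a = x ++ b ++ y
  split : (a ++ b) ++ (y ++ a) ≈ʷ a
  split =
    (a ++ b) ++ (y ++ a)               ≡⟨ solve (++-monoid V) ⟩
    x ++ ((b ++ y) ++ (b ++ y)) ++ a   ≈⟨ ++-congˡ x (++-congʳ a (idem (b ++ y))) ⟩
    x ++ (b ++ y) ++ a                 ≡⟨ solve (++-monoid V) ⟩
    a ++ a                             ≈⟨ idem a ⟩
    a                                  ∎ʷ

absorbs-++ : ∀ a u v → a absorbs u → a absorbs v → a absorbs (u ++ v)
absorbs-++ a u v au av = symʷ (
  a                                               ≈⟨ symʷ (idem a) ⟩
  a ++ a                                          ≈⟨ symʷ (++-cong av au) ⟩
  (a ++ v ++ a) ++ (a ++ u ++ a)                  ≡⟨ solve (++-monoid V) ⟩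
  -- Squaring `qp` produces the factor `auva`, in which `u` and `v` stand in the desired order.
  a ++ qp ++ a                                    ≈⟨ symʷ (++-congˡ a (++-congʳ a (idem qp))) ⟩
  a ++ (qp ++ qp) ++ a                            ≡⟨ solve (++-monoid V) ⟩
  (a ++ v ++ a) ++ ((a ++ u) ++ (v ++ a)) ++ (a ++ u ++ a)
    ≈⟨ ++-cong av (++-congˡ ((a ++ u) ++ (v ++ a)) au) ⟩
  a ++ ((a ++ u) ++ (v ++ a)) ++ a                ≡⟨ solve (++-monoid V) ⟩
  (a ++ a) ++ (u ++ v) ++ (a ++ a)                ≈⟨ ++-cong (idem a) (++-congˡ (u ++ v) (idem a)) ⟩
  a ++ (u ++ v) ++ a                              ∎ʷ)
  where
  qp = (v ++ a) ++ (a ++ u)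

⊆⇒absorbs : ∀ {u a} → u ⊆ a → a absorbs u
⊆⇒absorbs {[]}    {a} _ = idem a
⊆⇒absorbs {b ∷ u} {a} s with ∈-∃++ (s (here refl))
... | x , y , refl = absorbs-++ a (b ∷ []) u (absorbs-factor x (b ∷ []) y) (⊆⇒absorbs (s ∘ there))

-- Expanding `x` to `x ++ y ++ x` leaves `x ++ z` between two copies of `y`, which absorb it.
drop-middle : ∀ {x z y} → y ⊆ x → x ++ z ⊆ y → x ++ z ++ y ≈ʷ x ++ y
drop-middle {x} {z} {y} y⊆x xz⊆y =
  x ++ z ++ y                ≈⟨ symʷ (++-congʳ (z ++ y) (⊆⇒absorbs y⊆x)) ⟩
  (x ++ y ++ x) ++ z ++ y    ≡⟨ solve (++-monoid V) ⟩
  x ++ (y ++ (x ++ z) ++ y)  ≈⟨ ++-congˡ x (⊆⇒absorbs xz⊆y) ⟩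
  x ++ y                     ∎ʷ

before : V → Word → Word
before a []      = []
before a (x ∷ w) with a ≟ x
... | yes _ = []
... | no  _ = x ∷ before a w

before-∈ : ∀ {a u} v → a ∈ u → before a (u ++ v) ≡ before a u
before-∈ {a} {x ∷ u} v p with a ≟ x
... | yes _ = refl
before-∈ v (here a≡x) | no a≢x = contradiction a≡x a≢x
before-∈ v (there p)  | no _   = cong (_ ∷_) (before-∈ v p)

before-∉ : ∀ {a u} v → a ∉ u → before a (u ++ v) ≡ u ++ before a v
before-∉ {a} {[]}    v a∉u = refl
before-∉ {a} {x ∷ u} v a∉u with a ≟ x
... | yes a≡x = contradiction (here a≡x) a∉u
... | no  _   = cong (x ∷_) (before-∉ v (a∉u ∘ there))

before-head : ∀ a w → before a (a ∷ w) ≡ []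
before-head a w with a ≟ a
... | yes _  = refl
... | no a≢a = contradiction refl a≢a

before-prefix : ∀ a u → ∃[ q ] u ≡ before a u ++ q
before-prefix a []      = [] , refl
before-prefix a (x ∷ u) with a ≟ x
... | yes _ = x ∷ u , refl
... | no  _ = let q , e = before-prefix a u in q , cong (x ∷_) e

before-split : ∀ {a u} → a ∈ u → ∃[ q ] u ≡ (before a u ∷ʳ a) ++ q
before-split {a} {x ∷ u} p with a ≟ x
... | yes refl = u , refl
before-split (here a≡x) | no a≢x = contradiction a≡x a≢x
before-split (there p)  | no _   = let q , e = before-split p in q , cong (_ ∷_) e

before-⊆ : ∀ a u → before a u ⊆ u
before-⊆ a u p = let q , e = before-prefix a u in subst (_ ∈_) (sym e) (∈-++⁺ˡ p)

before-avoids : ∀ a u → a ∉ before a u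
before-avoids a (x ∷ u) p with a ≟ x
before-avoids a (x ∷ u) ()          | yes _
before-avoids a (x ∷ u) (here a≡x)  | no a≢x = a≢x a≡x
before-avoids a (x ∷ u) (there p)   | no _   = before-avoids a u p

-- Equivalent words have the same letters, so `a` occurs in both left factors or in neither; the
-- prefix then depends on them alone, or runs through them into the right factors.
before-cong : ∀ a {u v} → u ≈ʷ v → before a u ≈ʷ before a v
before-cong a (idem u) with a ∈? u
... | yes a∈u = ≡⇒≈ʷ (before-∈ u a∈u)
... | no  a∉u =
  before a (u ++ u)    ≡⟨ before-∉ u a∉u ⟩
  u ++ before a u      ≡⟨ cong (u ++_) before-u ⟩
  u ++ u               ≈⟨ idem u ⟩
  u                    ≡⟨ sym before-u ⟩
  before a u           ∎ʷ
  where
  before-u : before a u ≡ u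
  before-u = trans (cong (before a) (sym (++-identityʳ u))) (trans (before-∉ [] a∉u) (++-identityʳ u))
before-cong a reflʷ = reflʷ
before-cong a (symʷ p) = symʷ (before-cong a p)
before-cong a (transʷ p q) = transʷ (before-cong a p) (before-cong a q)
before-cong a (++-cong {u} {u′} {v} {v′} p q) with a ∈? u
... | yes a∈u = subst₂ _≈ʷ_ (sym (before-∈ v a∈u)) (sym (before-∈ v′ (≈ʷ⇒⊆ p a∈u))) (before-cong a p)
... | no  a∉u = subst₂ _≈ʷ_ (sym (before-∉ v a∉u)) (sym (before-∉ v′ (a∉u ∘ ≈ʷ⇒⊆ (symʷ p))))
                  (++-cong p (before-cong a q))

reverse-cong : ∀ {u v} → u ≈ʷ v → reverse u ≈ʷ reverse v
reverse-cong (idem u) = transʷ (≡⇒≈ʷ (reverse-++ u u)) (idem (reverse u))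
reverse-cong reflʷ = reflʷ
reverse-cong (symʷ p) = symʷ (reverse-cong p)
reverse-cong (transʷ p q) = transʷ (reverse-cong p) (reverse-cong q)
reverse-cong (++-cong {u} {u′} {v} {v′} p q) =
  subst₂ _≈ʷ_ (sym (reverse-++ u v)) (sym (reverse-++ u′ v′)) (++-cong (reverse-cong q) (reverse-cong p))

-- The letter sought is the one whose first occurrence comes last. Reading from the right, a final
-- letter that is new is the answer; a repeated one changes nothing.
last-new : ∀ u → u ≢ [] → ∃[ a ] a ∈ u × u ⊆ a ∷ before a u
last-new u u≢[] = go (reverseView u) u≢[]
  where
  go : ∀ {u} → Reverse u → u ≢ [] → ∃[ a ] a ∈ u × u ⊆ a ∷ before a u
  go []            ne = contradiction refl ne
  go (w ∶ r ∶ʳ x) _ with x ∈? w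
  ... | yes x∈w =
    let a , a∈w , w⊆ = go r (λ { refl → case-[] x∈w })
        same = before-∈ (x ∷ []) a∈w
        lift : w ⊆ a ∷ before a (w ∷ʳ x)
        lift = subst (λ b → w ⊆ a ∷ b) (sym same) w⊆
    in a , ∈-++⁺ˡ a∈w , ([ lift , (λ { (here refl) → lift x∈w }) ]′ ∘ ∈-++⁻ w)
    where
    case-[] : ∀ {x : V} → x ∉ []
    case-[] ()
  ... | no x∉w =
    x , ∈-++⁺ʳ w (here refl) ,
    ([ (λ p → there (subst (_ ∈_) (sym before-x) p)) , (λ { (here refl) → here refl }) ]′ ∘ ∈-++⁻ w)
    where
    before-x : before x (w ∷ʳ x) ≡ w
    before-x = trans (before-∉ (x ∷ []) x∉w) (trans (cong (w ++_) (before-head x [])) (++-identityʳ w))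

after : V → Word → Word
after b u = reverse (before b (reverse u))

infix 4 _spans_ _spansʳ_
_spans_ _spansʳ_ : V → Word → Set
a spans  u = a ∈ u × u ⊆ a ∷ before a u
b spansʳ u = b spans reverse u

-- Here `x` is the shortest prefix and `y` the shortest suffix of `u` containing all its letters. In
-- `u ++ u`, split as `x ++ q` and `r ++ y`, the middle `q ++ r` can therefore be dropped.
green-rees : ∀ {a b u} → a spans u → b spansʳ u → u ≈ʷ (before a u ∷ʳ a) ++ (b ∷ after b u)
green-rees {a} {b} {u} (a∈u , u⊆) (b∈u , ʳu⊆) with before-split a∈u | before-split b∈u
... | q , e | q′ , e′ =
  u                       ≈⟨ symʷ (idem u) ⟩
  u ++ u                  ≡⟨ cong₂ _++_ e uʳ ⟩
  (x ++ q) ++ (r ++ y)    ≡⟨ solve (++-monoid V) ⟩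
  x ++ (q ++ r) ++ y      ≈⟨ drop-middle (u⊆x ∘ y⊆u) (u⊆y ∘ xqr⊆u) ⟩
  x ++ y                  ∎ʷ
  where
  x = before a u ∷ʳ a
  y = b ∷ after b u
  r = reverse q′
  uʳ : u ≡ r ++ y
  uʳ = trans (sym (reverse-involutive u)) (trans (cong reverse e′)
       (trans (reverse-++ (before b (reverse u) ∷ʳ b) q′)
              (cong (r ++_) (reverse-++ (before b (reverse u)) (b ∷ [])))))
  y⊆u : y ⊆ u
  y⊆u p = subst (_ ∈_) (sym uʳ) (∈-++⁺ʳ r p)
  u⊆x : u ⊆ x
  u⊆x p with u⊆ p
  ... | here refl = ∈-++⁺ʳ (before a u) (here refl)
  ... | there p′  = ∈-++⁺ˡ p′
  u⊆y : u ⊆ y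
  u⊆y p with ʳu⊆ (reverse⁺ p)
  ... | here refl = here refl
  ... | there p′  = there (reverse⁺ p′)
  xqr⊆u : x ++ q ++ r ⊆ u
  xqr⊆u p with ∈-++⁻ (x ++ q) (subst (_ ∈_) (sym (++-assoc x q r)) p)
  ... | inj₁ p₁ = subst (_ ∈_) (sym e) p₁
  ... | inj₂ p₂ = subst (_ ∈_) (sym uʳ) (∈-++⁺ˡ p₂)

∃-spans : ∀ x u → ∃[ a ] a spans (x ∷ u)
∃-spans x u = last-new (x ∷ u) λ ()

∃-spansʳ : ∀ x u → ∃[ b ] b spansʳ (x ∷ u)
∃-spansʳ x u = last-new (reverse (x ∷ u)) λ e →
  contradiction (subst (x ∈_) e (reverse⁺ {xs = x ∷ u} (here refl))) λ ()

spans-resp : ∀ {a u v} → u ⊆ v → v ⊆ u → before a u ⊆ before a v → a spans u → a spans v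
spans-resp {a} u⊆v v⊆u b⊆ (a∈u , s) = u⊆v a∈u , ∷⁺ʳ a b⊆ ∘ s ∘ v⊆u

-- Decidability and finiteness for words over finitely many letters

remove : V → Word → Word
remove a = filter (λ x → ¬? (a ≟ x))

length-remove : ∀ {a l} → a ∈ l → length (remove a l) < length l
length-remove {a} {l} a∈l = filter-notAll (λ x → ¬? (a ≟ x)) l (Any.map (λ e ne → ne e) a∈l)

before-⊆-remove : ∀ {u l} a → u ⊆ l → before a u ⊆ remove a l
before-⊆-remove {u} a u⊆l p =
  ∈-filter⁺ (λ x → ¬? (a ≟ x)) (u⊆l (before-⊆ a u p)) (λ { refl → before-avoids a u p })

-- Depth n decides equality of words over fewer than n letters; suffixes are compared in reversed form.
Similar : ℕ → Word → Word → Set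
Similar zero    u v = ⊤
Similar (suc n) u v = (All (_∈ v) u × All (_∈ u) v) ×
  All (λ a → Similar n (before a u) (before a v) ×
             Similar n (before a (reverse u)) (before a (reverse v))) u

similar? : ∀ n u v → Dec (Similar n u v)
similar? zero    u v = yes tt
similar? (suc n) u v = (All.all? (_∈? v) u ×-dec All.all? (_∈? u) v) ×-dec
  All.all? (λ a → similar? n (before a u) (before a v) ×-dec
                  similar? n (before a (reverse u)) (before a (reverse v))) u

≈ʷ⇒similar : ∀ n {u v} → u ≈ʷ v → Similar n u v
≈ʷ⇒similar zero    p = tt
≈ʷ⇒similar (suc n) p = let u⊆v , v⊆u = ≈ʷ⇒⊆×⊇ p in
  (All.tabulate u⊆v , All.tabulate v⊆u) ,
  All.tabulate λ {a} _ → ≈ʷ⇒similar n (before-cong a p) , ≈ʷ⇒similar n (before-cong a (reverse-cong p))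

-- Prefixes and suffixes cut at a spanning letter avoid that letter, so the alphabet `l` shrinks
-- with the depth. The pieces are equivalent by induction, and `green-rees` reassembles both words
-- from them with the same two letters.
similar⇒≈ʷ : ∀ n l {u v} → u ⊆ l → length l < n → Similar n u v → u ≈ʷ v
similar⇒≈ʷ (suc n) l {[]}    {[]}    _ _ _ = reflʷ
similar⇒≈ʷ (suc n) l {[]}    {_ ∷ _} _ _ ((_ , () ∷ _) , _)
similar⇒≈ʷ (suc n) l {u@(x ∷ u′)} {v} u⊆l (s≤s l≤n) ((u∈v , v∈u) , sims)
  with ∃-spans x u′ | ∃-spansʳ x u′
... | a , a-u | b , b-u =
  u                                 ≈⟨ green-rees a-u b-u ⟩
  (before a u ∷ʳ a) ++ b ∷ after b u ≈⟨ ++-cong (++-congʳ (a ∷ []) left) (++-congˡ (b ∷ []) (reverse-cong right)) ⟩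
  (before a v ∷ʳ a) ++ b ∷ after b v
    ≈⟨ symʷ (green-rees (spans-resp u⊆v v⊆u (≈ʷ⇒⊆ left) a-u)
                        (spans-resp (reverse⁺ ∘ u⊆v ∘ reverse⁻) (reverse⁺ ∘ v⊆u ∘ reverse⁻) (≈ʷ⇒⊆ right) b-u)) ⟩
  v                                 ∎ʷ
  where
  u⊆v = All.lookup u∈v
  v⊆u = All.lookup v∈u
  left : before a u ≈ʷ before a v
  left = similar⇒≈ʷ n (remove a l) (before-⊆-remove a u⊆l)
           (<-≤-trans (length-remove (u⊆l (proj₁ a-u))) l≤n) (proj₁ (All.lookup sims (proj₁ a-u)))
  b∈u : b ∈ u
  b∈u = reverse⁻ (proj₁ b-u)
  right : before b (reverse u) ≈ʷ before b (reverse v)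
  right = similar⇒≈ʷ n (remove b l) (before-⊆-remove b (u⊆l ∘ reverse⁻))
           (<-≤-trans (length-remove (u⊆l b∈u)) l≤n) (proj₂ (All.lookup sims b∈u))

infix 4 _≈ʷ?_
_≈ʷ?_ : ∀ u v → Dec (u ≈ʷ v)
u ≈ʷ? v = map′ (similar⇒≈ʷ (suc (length u)) u id ≤-refl) (≈ʷ⇒similar _) (similar? (suc (length u)) u v)

wordReps : Word → ℕ → List Word
wordReps l zero    = [] ∷ []
wordReps l (suc n) = [] ∷ cartesianProductWith _++_
  (cartesianProductWith _∷ʳ_ (wordReps l n) l) (cartesianProductWith _∷_ l (wordReps l n))

-- The alphabet is passed twice: `l` stays fixed and supplies the letters of the list, while `k`
-- loses a letter at each level and so bounds the depth.
wordReps-complete : ∀ {l} n k {u} → u ⊆ l → u ⊆ k → length k ≤ n → ∃[ r ] r ∈ wordReps l n × u ≈ʷ r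
wordReps-complete zero    _      {[]}    _ _ _ = [] , here refl , reflʷ
wordReps-complete (suc n) _      {[]}    _ _ _ = [] , here refl , reflʷ
wordReps-complete zero    []     {_ ∷ _} _ u⊆k _ = contradiction (u⊆k (here refl)) λ ()
wordReps-complete {l} (suc n) k {u@(x ∷ u′)} u⊆l u⊆k k≤1+n with ∃-spans x u′ | ∃-spansʳ x u′
... | a , a-u | b , b-u
  with wordReps-complete n (remove a k) {before a u} (u⊆l ∘ before-⊆ a u) (before-⊆-remove a u⊆k)
         (≤-pred (<-≤-trans (length-remove (u⊆k (proj₁ a-u))) k≤1+n))
     | wordReps-complete n (remove b k) {after b u} (u⊆l ∘ reverse⁻ ∘ before-⊆ b (reverse u) ∘ reverse⁻)
         (before-⊆-remove b (u⊆k ∘ reverse⁻) ∘ reverse⁻)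
         (≤-pred (<-≤-trans (length-remove (u⊆k (reverse⁻ (proj₁ b-u)))) k≤1+n))
... | r , r∈ , p | r′ , r′∈ , p′ =
  (r ∷ʳ a) ++ b ∷ r′ ,
  there (∈-cartesianProductWith⁺ _++_ (∈-cartesianProductWith⁺ _∷ʳ_ r∈ (u⊆l a∈u))
                                      (∈-cartesianProductWith⁺ _∷_ (u⊆l b∈u) r′∈)) ,
  transʷ (green-rees a-u b-u) (++-cong (++-congʳ (a ∷ []) p) (++-congˡ (b ∷ []) p′))
  where
  a∈u = proj₁ a-u
  b∈u = reverse⁻ (proj₁ b-u)

-- Variables and bounded substitutions

unique-lookup-injective : ∀ {xs : List V} → Unique xs → ∀ i j → lookup xs i ≡ lookup xs j → i ≡ j
unique-lookup-injective (_ ∷ _)    zero    zero    _ = refl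
unique-lookup-injective (x∉ ∷ _)   zero    (suc j) e = contradiction e (All.lookup x∉ (∈-lookup j))
unique-lookup-injective (x∉ ∷ _)   (suc i) zero    e = contradiction (sym e) (All.lookup x∉ (∈-lookup i))
unique-lookup-injective (_ ∷ xs!)  (suc i) (suc j) e = cong suc (unique-lookup-injective xs! i j e)

unique-⊆⇒length≤ : ∀ {xs ys : List V} → Unique xs → xs ⊆ ys → length xs ≤ length ys
unique-⊆⇒length≤ {xs} {ys} xs! xs⊆ys = injective⇒≤ {f = λ i → index (place i)} λ {i} {j} e →
  unique-lookup-injective xs! i j
    (trans (lookup-index (place i)) (trans (cong (lookup ys) e) (sym (lookup-index (place j)))))
  where
  place : ∀ i → lookup xs i ∈ ys
  place i = xs⊆ys (∈-lookup i)

∃-bound : (xs : List V) → ∃[ k ] (∀ {v} → v ∈ xs → v < k)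
∃-bound []       = 0 , λ ()
∃-bound (x ∷ xs) = let k , p = ∃-bound xs in
  suc x ⊔ k , λ { (here refl) → m≤m⊔n (suc x) k ; (there q) → ≤-trans (p q) (m≤n⊔m (suc x) k) }

module _ {Sg : Signature} where

  mutual
    vars : Term Sg → List V
    vars (var x)   = x ∷ []
    vars (op g ts) = vars* ts

    vars* : ∀ {n} → Vec (Term Sg) n → List V
    vars* []       = []
    vars* (t ∷ ts) = vars t ++ vars* ts

  mutual
    vars-[]⁻ : ∀ t {σ : Map Sg} {v} → v ∈ vars (t [ σ ]) → ∃[ y ] y ∈ vars t × v ∈ vars (σ y)
    vars-[]⁻ (var x)   p = x , here refl , p
    vars-[]⁻ (op g ts) p = vars-[]*⁻ ts p

    vars-[]*⁻ : ∀ {n} (ts : Vec (Term Sg) n) {σ : Map Sg} {v} →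
                v ∈ vars* (ts [ σ ]*) → ∃[ y ] y ∈ vars* ts × v ∈ vars (σ y)
    vars-[]*⁻ (t ∷ ts) {σ} p with ∈-++⁻ (vars (t [ σ ])) p
    ... | inj₁ q = let y , y∈ , r = vars-[]⁻ t q in y , ∈-++⁺ˡ y∈ , r
    ... | inj₂ q = let y , y∈ , r = vars-[]*⁻ ts q in y , ∈-++⁺ʳ (vars t) y∈ , r

  mutual
    vars-[]⁺ : ∀ t {σ : Map Sg} {y v} → y ∈ vars t → v ∈ vars (σ y) → v ∈ vars (t [ σ ])
    vars-[]⁺ (var x)   (here refl) q = q
    vars-[]⁺ (op g ts) p           q = vars-[]*⁺ ts p q

    vars-[]*⁺ : ∀ {n} (ts : Vec (Term Sg) n) {σ : Map Sg} {y v} →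
                y ∈ vars* ts → v ∈ vars (σ y) → v ∈ vars* (ts [ σ ]*)
    vars-[]*⁺ (t ∷ ts) {σ} p q with ∈-++⁻ (vars t) p
    ... | inj₁ r = ∈-++⁺ˡ (vars-[]⁺ t r q)
    ... | inj₂ r = ∈-++⁺ʳ (vars (t [ σ ])) (vars-[]*⁺ ts r q)

  mutual
    []-cong : ∀ t {σ τ : Map Sg} → (∀ {y} → y ∈ vars t → σ y ≡ τ y) → t [ σ ] ≡ t [ τ ]
    []-cong (var x)   e = e (here refl)
    []-cong (op g ts) e = cong (op g) ([]*-cong ts e)

    []*-cong : ∀ {n} (ts : Vec (Term Sg) n) {σ τ : Map Sg} →
               (∀ {y} → y ∈ vars* ts → σ y ≡ τ y) → ts [ σ ]* ≡ ts [ τ ]*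
    []*-cong []       e = refl
    []*-cong (t ∷ ts) e = cong₂ _∷_ ([]-cong t (e ∘ ∈-++⁺ˡ)) ([]*-cong ts (e ∘ ∈-++⁺ʳ (vars t)))

  mutual
    []-∘ : ∀ t (σ τ : Map Sg) → t [ σ ] [ τ ] ≡ t [ (λ x → σ x [ τ ]) ]
    []-∘ (var x)   σ τ = refl
    []-∘ (op g ts) σ τ = cong (op g) ([]*-∘ ts σ τ)

    []*-∘ : ∀ {n} (ts : Vec (Term Sg) n) (σ τ : Map Sg) → ts [ σ ]* [ τ ]* ≡ ts [ (λ x → σ x [ τ ]) ]*
    []*-∘ []       σ τ = refl
    []*-∘ (t ∷ ts) σ τ = cong₂ _∷_ ([]-∘ t σ τ) ([]*-∘ ts σ τ)

  mutual
    [var] : (t : Term Sg) → t [ var ] ≡ t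
    [var] (var x)   = refl
    [var] (op g ts) = cong (op g) ([var]* ts)

    [var]* : ∀ {n} (ts : Vec (Term Sg) n) → ts [ var ]* ≡ ts
    [var]* []       = refl
    [var]* (t ∷ ts) = cong₂ _∷_ ([var] t) ([var]* ts)

  [≡var] : ∀ t {σ : Map Sg} → (∀ {y} → y ∈ vars t → σ y ≡ var y) → t [ σ ] ≡ t
  [≡var] t e = trans ([]-cong t e) ([var] t)

  ≟var : ∀ (t : Term Sg) x → Dec (t ≡ var x)
  ≟var (var y)   x = map′ (cong var) (λ { refl → refl }) (y ≟ x)
  ≟var (op g ts) x = no λ ()

  Below : ℕ → Pred (Term Sg) 0ℓ
  Below k t = ∀ v → v ∈ vars t → v < k

  cutMap : ℕ → Map Sg → Map Sg
  cutMap k m x with x <? k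
  ... | yes _ = m x
  ... | no  _ = var x

  cutMap-< : ∀ {k x} m → x < k → cutMap k m x ≡ m x
  cutMap-< {k} {x} m x<k with x <? k
  ... | yes _   = refl
  ... | no  x≮k = contradiction x<k x≮k

  cutMap-≥ : ∀ {k x} m → k ≤ x → cutMap k m x ≡ var x
  cutMap-≥ {k} {x} m k≤x with x <? k
  ... | yes x<k = contradiction k≤x (<⇒≱ x<k)
  ... | no  _   = refl

  cut : ℕ → Map Sg → Substitution Sg
  cut k m = record
    { ⟦_⟧           = cutMap k m
    ; domain        = upTo k
    ; domain-covers = λ x moved → ∈-upTo⁺ (moved⇒< x moved)
    }
    where
    moved⇒< : ∀ x → cutMap k m x ≢ var x → x < k
    moved⇒< x moved with x <? k
    ... | yes x<k = x<k
    ... | no  _   = contradiction refl moved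

  cut-id : ∀ {k} m → (∀ {x} → k ≤ x → m x ≡ var x) → ∀ x → ⟦ cut k m ⟧ x ≡ m x
  cut-id {k} m e x with x <? k
  ... | yes _   = refl
  ... | no  x≮k = sym (e (≮⇒≥ x≮k))

  -- This is what it means to live on the first `k` variables.
  record Bounded (k : ℕ) (σ : Substitution Sg) : Set where
    field
      fixes : ∀ {x} → k ≤ x → ⟦ σ ⟧ x ≡ var x
      below : ∀ {x} → x < k → Below k (⟦ σ ⟧ x)

  open Bounded public

  bounded-mono : ∀ {k k′ σ} → k ≤ k′ → Bounded k σ → Bounded k′ σ
  bounded-mono k≤k′ b .fixes k′≤x = b .fixes (≤-trans k≤k′ k′≤x)
  bounded-mono {k} k≤k′ b .below {x} x<k′ v p with x <? k
  ... | yes x<k = <-≤-trans (b .below x<k v p) k≤k′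
  ... | no  x≮k with subst (λ t → _ ∈ vars t) (b .fixes (≮⇒≥ x≮k)) p
  ...   | here refl = x<k′

  ∃-bounded : ∀ σ → ∃[ k ] Bounded k σ
  ∃-bounded σ = k , record { fixes = λ k≤x → fix (λ x∈ → <⇒≱ (x<k (∈-++⁺ˡ x∈)) k≤x) ; below = below′ }
    where
    open Substitution σ using (domain; domain-covers)
    range : List V
    range = concatMap (vars ∘ ⟦ σ ⟧) domain
    k    = proj₁ (∃-bound (domain ++ range))
    x<k  = proj₂ (∃-bound (domain ++ range))
    fix : ∀ {x} → x ∉ domain → ⟦ σ ⟧ x ≡ var x
    fix {x} x∉ with ≟var (⟦ σ ⟧ x) x
    ... | yes e = e
    ... | no  ne = contradiction (domain-covers x ne) x∉
    below′ : ∀ {x} → x < k → Below k (⟦ σ ⟧ x)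
    below′ {x} x<k′ v p with x ∈? domain
    ... | yes x∈ = x<k (∈-++⁺ʳ domain (∈-concatMap⁺ (vars ∘ ⟦ σ ⟧) (lose x∈ p)))
    ... | no  x∉ with subst (λ t → _ ∈ vars t) (fix x∉) p
    ...   | here refl = x<k′

  module _ (E : Theory Sg) where

    ≡⇒⊢ : ∀ {s t} → s ≡ t → E ⊢ s ≈ t
    ≡⇒⊢ refl = reflexive

    mutual
      ⊢-[] : ∀ {s t} (σ : Map Sg) → E ⊢ s ≈ t → E ⊢ s [ σ ] ≈ t [ σ ]
      ⊢-[] σ (instance-of {s} {t} e τ) =
        subst₂ (E ⊢_≈_) (sym ([]-∘ s τ σ)) (sym ([]-∘ t τ σ)) (instance-of e _)
      ⊢-[] σ reflexive        = reflexive
      ⊢-[] σ (symmetric p)    = symmetric (⊢-[] σ p)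
      ⊢-[] σ (transitive p q) = transitive (⊢-[] σ p) (⊢-[] σ q)
      ⊢-[] σ (congruent g ps) = congruent g (⊢-[]* σ ps)

      ⊢-[]* : ∀ {n} {ss ts : Vec (Term Sg) n} (σ : Map Sg) → Pointwise (E ⊢_≈_) ss ts →
              Pointwise (E ⊢_≈_) (ss [ σ ]*) (ts [ σ ]*)
      ⊢-[]* σ []       = []
      ⊢-[]* σ (p ∷ ps) = ⊢-[] σ p ∷ ⊢-[]* σ ps

    mutual
      []-⊢ : ∀ t {σ τ : Map Sg} → (∀ {y} → y ∈ vars t → E ⊢ σ y ≈ τ y) → E ⊢ t [ σ ] ≈ t [ τ ]
      []-⊢ (var x)   e = e (here refl)
      []-⊢ (op g ts) e = congruent g ([]*-⊢ ts e)

      []*-⊢ : ∀ {n} (ts : Vec (Term Sg) n) {σ τ : Map Sg} →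
              (∀ {y} → y ∈ vars* ts → E ⊢ σ y ≈ τ y) → Pointwise (E ⊢_≈_) (ts [ σ ]*) (ts [ τ ]*)
      []*-⊢ []       e = []
      []*-⊢ (t ∷ ts) e = []-⊢ t (e ∘ ∈-++⁺ˡ) ∷ []*-⊢ ts (e ∘ ∈-++⁺ʳ (vars t))

  ∃-below : ∀ (Γ : Problem Sg) → ∃[ k ] All (λ (s , t) → Below k s × Below k t) Γ
  ∃-below []            = 0 , []
  ∃-below ((s , t) ∷ Γ) =
    let k , ps = ∃-below Γ ; k′ , p = ∃-bound (vars s ++ vars t) in
    k ⊔ k′ ,
    ((λ v q → ≤-trans (p (∈-++⁺ˡ q)) (m≤n⊔m k k′)) , (λ v q → ≤-trans (p (∈-++⁺ʳ (vars s) q)) (m≤n⊔m k k′))) ∷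
    All.map (λ (a , b) → (λ v q → ≤-trans (a v q) (m≤m⊔n k k′)) , (λ v q → ≤-trans (b v q) (m≤m⊔n k k′))) ps

-- Existence of minimal complete sets

-- The reverse inclusion follows by symmetry. Variables cannot disappear under equality in `E`, so
-- occurrences can be traced through instances in both directions.
module Regular {Sg : Signature} (E : Theory Sg)
  (regular : ∀ {s t} → E ⊢ s ≈ t → vars s ⊆ vars t) where

  infix 4 _≲_
  _≲_ : Substitution Sg → Substitution Sg → Set
  _≲_ = _≼_ E

  ≃⇒≲ : ∀ σ τ → (∀ x → E ⊢ ⟦ σ ⟧ x ≈ ⟦ τ ⟧ x) → σ ≲ τ
  ≃⇒≲ σ τ e = cut 0 var , λ x →
    transitive (≡⇒⊢ E ([≡var] (⟦ σ ⟧ x) λ _ → cut-id {k = 0} var (λ _ → refl) _)) (e x)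

  ≲-refl : ∀ σ → σ ≲ σ
  ≲-refl σ = ≃⇒≲ σ σ λ _ → reflexive

  ≲-trans : ∀ σ τ υ → σ ≲ τ → τ ≲ υ → σ ≲ υ
  -- A witness needs a finite domain. The composite map fixes every variable beyond the bounds of
  -- `α` and `β`, so cutting it there is harmless.
  ≲-trans σ τ υ (α , p) (β , q) = cut k γ , λ x →
    transitive (≡⇒⊢ E (trans ([]-cong (⟦ σ ⟧ x) λ _ → cut-id γ fixes-γ _) (sym ([]-∘ (⟦ σ ⟧ x) ⟦ α ⟧ ⟦ β ⟧))))
    (transitive (⊢-[] E ⟦ β ⟧ (p x)) (q x))
    where
    γ : Map Sg
    γ x = ⟦ α ⟧ x [ ⟦ β ⟧ ]
    kα = proj₁ (∃-bounded α)
    kβ = proj₁ (∃-bounded β)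
    k = kα ⊔ kβ
    fixes-γ : ∀ {x} → k ≤ x → γ x ≡ var x
    fixes-γ {x} k≤x = trans
      (cong _[ ⟦ β ⟧ ] (proj₂ (∃-bounded α) .fixes (≤-trans (m≤m⊔n kα kβ) k≤x)))
      (proj₂ (∃-bounded β) .fixes (≤-trans (m≤n⊔m kα kβ) k≤x))

  instance-vars : ∀ σ τ (i : σ ≲ τ) x {y v} → y ∈ vars (⟦ σ ⟧ x) → v ∈ vars (⟦ proj₁ i ⟧ y) → v ∈ vars (⟦ τ ⟧ x)
  instance-vars σ τ (_ , p) x y∈ v∈ = regular (p x) (vars-[]⁺ (⟦ σ ⟧ x) y∈ v∈)

  instance-vars⁻ : ∀ σ τ (i : σ ≲ τ) x {v} → v ∈ vars (⟦ τ ⟧ x) →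
                   ∃[ y ] y ∈ vars (⟦ σ ⟧ x) × v ∈ vars (⟦ proj₁ i ⟧ y)
  instance-vars⁻ σ τ (_ , p) x v∈ = vars-[]⁻ (⟦ σ ⟧ x) (regular (symmetric (p x)) v∈)

  module Reduction {k} (θ σ : Substitution Sg) (θ-bounded : Bounded k θ) (σ≲θ : σ ≲ θ) where

    private
      λ′ = proj₁ σ≲θ
      d  = proj₁ (∃-bounded σ)

      σ-bounded : Bounded (k + d) σ
      σ-bounded = bounded-mono (m≤n+m d k) (proj₂ (∃-bounded σ))

      used : List V
      used = deduplicate _≟_ (concatMap (vars ∘ ⟦ σ ⟧) (upTo k))

      used⁺ : ∀ {x y} → x < k → y ∈ vars (⟦ σ ⟧ x) → y ∈ used
      used⁺ x<k p = ∈-deduplicate⁺ _≟_ (∈-concatMap⁺ (vars ∘ ⟦ σ ⟧) (lose (∈-upTo⁺ x<k) p))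

      used⁻ : ∀ {y} → y ∈ used → ∃[ x ] x < k × y ∈ vars (⟦ σ ⟧ x)
      used⁻ p = let x , x∈ , q = find (∈-concatMap⁻ (vars ∘ ⟦ σ ⟧) (∈-deduplicate⁻ _≟_ _ p)) in x , ∈-upTo⁻ x∈ , q

      -- For x ≥ k the term σ x is mapped to x, so it contains a variable mapped to x alone.
      pick : ∀ x → k ≤ x → ∃[ y ] y ∈ vars (⟦ σ ⟧ x) × x ∈ vars (⟦ λ′ ⟧ y)
      pick x k≤x = instance-vars⁻ σ θ σ≲θ x (subst (λ t → x ∈ vars t) (sym (θ-bounded .fixes k≤x)) (here refl))

      high : Fin d → V
      high i = k + toℕ i

      picked : Fin d → V
      picked i = proj₁ (pick (high i) (m≤m+n k (toℕ i)))

      picked-∈ : ∀ i → picked i ∈ vars (⟦ σ ⟧ (high i)) × high i ∈ vars (⟦ λ′ ⟧ (picked i))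
      picked-∈ i = proj₂ (pick (high i) (m≤m+n k (toℕ i)))

      -- If `picked i` and `picked j` agree, then `high i` occurs in `⟦ θ ⟧ (high j)`, which is the
      -- variable `high j`.
      picked-injective : ∀ {i j} → picked i ≡ picked j → i ≡ j
      picked-injective {i} {j} e
        with subst (λ t → high i ∈ vars t) (θ-bounded .fixes (m≤m+n k (toℕ j)))
               (instance-vars σ θ σ≲θ (high j) (proj₁ (picked-∈ j))
                 (subst (λ y → high i ∈ vars (⟦ λ′ ⟧ y)) e (proj₂ (picked-∈ i))))
      ... | here e′ = toℕ-injective (+-cancelˡ-≡ k _ _ e′)

      -- A variable that is both would carry `high i`, which is at least `k`, into the image under
      -- `θ` of a variable below `k`.
      disjoint : ∀ {y} → ¬ (y ∈ used × y ∈ tabulate picked)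
      disjoint (p , q) with used⁻ p | ∈-tabulate⁻ q
      ... | x , x<k , y∈ | i , refl = <⇒≱
        (θ-bounded .below x<k (high i) (instance-vars σ θ σ≲θ x y∈ (proj₂ (picked-∈ i))))
        (m≤m+n k (toℕ i))

      all⊆ : used ++ tabulate picked ⊆ upTo (k + d)
      all⊆ p with ∈-++⁻ used p
      ... | inj₁ q = let x , x<k , y∈ = used⁻ q in
        ∈-upTo⁺ (σ-bounded .below (<-≤-trans x<k (m≤m+n k d)) _ y∈)
      ... | inj₂ q with ∈-tabulate⁻ q
      ...   | i , refl = ∈-upTo⁺ (σ-bounded .below (+-monoʳ-< k (toℕ<n i)) _ (proj₁ (picked-∈ i)))

      -- The `used` variables and the `d` picked ones are distinct and all lie below `k + d`, so at
      -- most `k` places remain for the former.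
      length-used : length used ≤ k
      length-used = +-cancelʳ-≤ d (length used) k
        (subst₂ _≤_
          (trans (length-++ used) (cong (length used +_) (length-tabulate picked)))
          (length-upTo (k + d))
          (unique-⊆⇒length≤
            (Unique.++⁺ (deduplicate-! _) (Unique.tabulate⁺ picked-injective) disjoint) all⊆))

      -- The new name of a variable is its position in `used`. Terms `⟦ σ ⟧ x` with `x < k` contain
      -- no others, so the value 0 is arbitrary.
      ρ : V → V
      ρ y with y ∈? used
      ... | yes p = toℕ (index p)
      ... | no  _ = 0

      ρ⁻¹ : V → V
      ρ⁻¹ i with i <? length used
      ... | yes p = lookup used (fromℕ< p)
      ... | no  _ = 0

      ρ<k : ∀ {y} → y ∈ used → ρ y < k
      ρ<k {y} y∈ with y ∈? used
      ... | yes p = <-≤-trans (toℕ<n (index p)) length-used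
      ... | no ¬p = contradiction y∈ ¬p

      ρ⁻¹-ρ : ∀ {y} → y ∈ used → ρ⁻¹ (ρ y) ≡ y
      ρ⁻¹-ρ {y} y∈ with y ∈? used
      ... | no ¬p = contradiction y∈ ¬p
      ... | yes p with toℕ (index p) <? length used
      ...   | yes q = trans (cong (lookup used) (fromℕ<-toℕ (index p) q)) (sym (lookup-index p))
      ...   | no ¬q = contradiction (toℕ<n (index p)) ¬q

    renaming-map : Map Sg
    renaming-map = var ∘ ρ

    private
      σ-renamed : Map Sg
      σ-renamed x = ⟦ σ ⟧ x [ renaming-map ]

    reduced : Substitution Sg
    reduced = cut k σ-renamed

    reduced-< : ∀ {x} → x < k → ⟦ reduced ⟧ x ≡ ⟦ σ ⟧ x [ renaming-map ]
    reduced-< = cutMap-< σ-renamed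

    reduced-bounded : Bounded k reduced
    reduced-bounded .fixes = cutMap-≥ σ-renamed
    reduced-bounded .below {x} x<k v p
      with vars-[]⁻ (⟦ σ ⟧ x) (subst (λ t → v ∈ vars t) (reduced-< x<k) p)
    ... | y , y∈ , here refl = ρ<k (used⁺ x<k y∈)

    private
      -- Below `k` the map undoes the renaming; from `k` on, where `reduced` is the identity, it has
      -- to act as `σ` itself.
      μ-map : Map Sg
      μ-map i with i <? k
      ... | yes _ = var (ρ⁻¹ i)
      ... | no  _ = ⟦ σ ⟧ i

      μ-< : ∀ {i} → i < k → μ-map i ≡ var (ρ⁻¹ i)
      μ-< {i} i<k with i <? k
      ... | yes _  = refl
      ... | no i≮k = contradiction i<k i≮k

      μ-≥ : ∀ {i} → k ≤ i → μ-map i ≡ ⟦ σ ⟧ i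
      μ-≥ {i} k≤i with i <? k
      ... | yes i<k = contradiction k≤i (<⇒≱ i<k)
      ... | no  _   = refl

      μ : Substitution Sg
      μ = cut (k + d) μ-map

      μ-id : ∀ x → ⟦ μ ⟧ x ≡ μ-map x
      μ-id = cut-id μ-map λ k+d≤x → trans (μ-≥ (≤-trans (m≤m+n k d) k+d≤x)) (σ-bounded .fixes k+d≤x)

    reduced≲ : reduced ≲ σ
    reduced≲ = μ , λ x → ≡⇒⊢ E (μ-works x)
      where
      μ-works : ∀ x → ⟦ reduced ⟧ x [ ⟦ μ ⟧ ] ≡ ⟦ σ ⟧ x
      μ-works x with x <? k
      ... | yes x<k = trans ([]-∘ (⟦ σ ⟧ x) renaming-map ⟦ μ ⟧)
        ([≡var] (⟦ σ ⟧ x) λ {y} y∈ →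
          trans (μ-id (ρ y)) (trans (μ-< (ρ<k (used⁺ x<k y∈))) (cong var (ρ⁻¹-ρ (used⁺ x<k y∈)))))
      ... | no x≮k = trans (μ-id x) (μ-≥ (≮⇒≥ x≮k))

    -- All variables of `Γ` lie below `k`, where `reduced` is `σ` followed by a renaming, and
    -- substituting preserves equality in `E`.
    reduced-unifier : ∀ {Γ} → All (λ (s , t) → Below k s × Below k t) Γ → Unifier E Γ σ → Unifier E Γ reduced
    reduced-unifier Γ-below σ-unifies = All.zipWith
      (λ { {s , t} ((s<k , t<k) , p) →
        subst₂ (E ⊢_≈_) (sym (factor s s<k)) (sym (factor t t<k)) (⊢-[] E renaming-map p) })
      (Γ-below , σ-unifies)
      where
      factor : ∀ s → Below k s → s [ ⟦ reduced ⟧ ] ≡ s [ ⟦ σ ⟧ ] [ renaming-map ]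
      factor s s<k = trans ([]-cong s (λ y∈ → reduced-< (s<k _ y∈))) (sym ([]-∘ s ⟦ σ ⟧ renaming-map))

-- The finite list `reps k` meets every class of terms over the first `k` variables, which makes `E`
-- locally finite.
module LocallyFinite {Sg : Signature} (E : Theory Sg)
  (regular : ∀ {s t} → E ⊢ s ≈ t → vars s ⊆ vars t)
  (⊢-dec : ∀ s t → Dec (E ⊢ s ≈ t))
  (reps : ℕ → List (Term Sg))
  (reps-complete : ∀ k t → Below k t → ∃[ r ] r ∈ reps k × E ⊢ r ≈ t) where

  open Regular E regular

  update : ℕ → Term Sg → Map Sg → Map Sg
  update n r m x with x ≟ n
  ... | yes _ = r
  ... | no  _ = m x

  maps : List (Term Sg) → ℕ → List (Map Sg)
  maps rs zero    = var ∷ []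
  maps rs (suc n) = cartesianProductWith (update n) rs (maps rs n)

  maps-complete : ∀ rs n (f : Map Sg) → (∀ {x} → x < n → ∃[ r ] r ∈ rs × E ⊢ r ≈ f x) →
                  ∃[ m ] m ∈ maps rs n × (∀ {x} → x < n → E ⊢ m x ≈ f x)
  maps-complete rs zero    f h = var , here refl , λ ()
  maps-complete rs (suc n) f h
    with maps-complete rs n f (λ x<n → h (≤-trans x<n (n≤1+n n))) | h ≤-refl
  ... | m , m∈ , p | r , r∈ , q = update n r m , ∈-cartesianProductWith⁺ (update n) r∈ m∈ , agrees
    where
    agrees : ∀ {x} → x < suc n → E ⊢ update n r m x ≈ f x
    agrees {x} x≤n with x ≟ n
    ... | yes refl = q
    ... | no  x≢n  = p (≤∧≢⇒< (≤-pred x≤n) x≢n)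

  infix 4 _≲?_
  -- Beyond a common bound `k` both substitutions are the identity, and below it a witness matters
  -- only on the first `k` variables and up to `E`. So only finitely many witnesses, with values in
  -- `reps k`, have to be tried.
  _≲?_ : ∀ σ τ → Dec (σ ≲ τ)
  σ ≲? τ = map′ from to
    (Any.any? (λ m → allUpTo? (λ x → ⊢-dec (⟦ σ ⟧ x [ ⟦ cut k m ⟧ ]) (⟦ τ ⟧ x)) k) (maps (reps k) k))
    where
    kσ = proj₁ (∃-bounded σ)
    kτ = proj₁ (∃-bounded τ)
    k = kσ ⊔ kτ
    σ-bounded : Bounded k σ
    σ-bounded = bounded-mono (m≤m⊔n kσ kτ) (proj₂ (∃-bounded σ))
    τ-bounded : Bounded k τ
    τ-bounded = bounded-mono (m≤n⊔m kσ kτ) (proj₂ (∃-bounded τ))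

    Solves : Map Sg → Set
    Solves m = ∀ {x} → x < k → E ⊢ ⟦ σ ⟧ x [ ⟦ cut k m ⟧ ] ≈ ⟦ τ ⟧ x

    from : Any Solves (maps (reps k) k) → σ ≲ τ
    from any with find any
    ... | m , _ , p = cut k m , everywhere
      where
      everywhere : ∀ x → E ⊢ ⟦ σ ⟧ x [ ⟦ cut k m ⟧ ] ≈ ⟦ τ ⟧ x
      everywhere x with x <? k
      ... | yes x<k = p x<k
      ... | no  x≮k = ≡⇒⊢ E (trans (cong _[ ⟦ cut k m ⟧ ] (σ-bounded .fixes (≮⇒≥ x≮k)))
                       (trans (cutMap-≥ m (≮⇒≥ x≮k)) (sym (τ-bounded .fixes (≮⇒≥ x≮k)))))

    -- Variables outside the range of interest may be collapsed to any variable below k.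
    collapse : Map Sg
    collapse z with z <? k
    ... | yes _ = var z
    ... | no  _ = var 0

    collapse-< : ∀ {z} → z < k → collapse z ≡ var z
    collapse-< {z} z<k with z <? k
    ... | yes _   = refl
    ... | no  z≮k = contradiction z<k z≮k

    -- The bound `y < k` ensures that `k` is positive and hence that 0 lies below it.
    collapse-below : ∀ {y} z → y < k → Below k (collapse z)
    collapse-below z y<k v p with z <? k
    collapse-below z y<k v (here refl) | yes z<k = z<k
    collapse-below z y<k v (here refl) | no  _   = ≤-<-trans z≤n y<k

    to : σ ≲ τ → Any Solves (maps (reps k) k)
    to (λ′ , p) with maps-complete (reps k) k (λ y → ⟦ λ′ ⟧ y [ collapse ])
      (λ {y} y<k → reps-complete k (⟦ λ′ ⟧ y [ collapse ]) λ v v∈ →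
        let z , _ , v∈′ = vars-[]⁻ (⟦ λ′ ⟧ y) v∈ in collapse-below z y<k v v∈′)
    ... | m , m∈ , q = lose m∈ λ {x} x<k →
      transitive ([]-⊢ E (⟦ σ ⟧ x) λ {y} y∈ →
        let y<k = σ-bounded .below x<k y y∈ in transitive (≡⇒⊢ E (cutMap-< m y<k)) (q y<k))
      (transitive (≡⇒⊢ E (sym ([]-∘ (⟦ σ ⟧ x) ⟦ λ′ ⟧ collapse)))
      (transitive (⊢-[] E collapse (p x))
        (≡⇒⊢ E ([≡var] (⟦ τ ⟧ x) λ y∈ → collapse-< (τ-bounded .below x<k _ y∈)))))

  candidates : ℕ → List (Substitution Sg)
  candidates k = List.map (cut k) (maps (reps k) k)

  infix 4 _∼_
  _∼_ : Substitution Sg → Substitution Sg → Set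
  σ ∼ τ = σ ≲ τ × τ ≲ σ

  candidates-complete : ∀ {k} σ → Bounded k σ → ∃[ c ] c ∈ candidates k × c ∼ σ
  candidates-complete {k} σ b
    with maps-complete (reps k) k ⟦ σ ⟧ (λ {x} x<k → reps-complete k (⟦ σ ⟧ x) (b .below x<k))
  ... | m , m∈ , p = cut k m , ∈-map⁺ (cut k) m∈ , ≃⇒≲ (cut k m) σ same , ≃⇒≲ σ (cut k m) (symmetric ∘ same)
    where
    same : ∀ x → E ⊢ cutMap k m x ≈ ⟦ σ ⟧ x
    same x with x <? k
    ... | yes x<k = p x<k
    ... | no  x≮k = ≡⇒⊢ E (sym (b .fixes (≮⇒≥ x≮k)))

  -- One pass suffices: the current bound only decreases, so a member rejected earlier is still not
  -- below the final `m`, and an accepted one lies above `m`.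
  least-below : ∀ xs σ → ∃[ m ] (m ≡ σ ⊎ m ∈ xs) × m ≲ σ × (∀ {τ} → τ ∈ xs → τ ≲ m → m ≲ τ)
  least-below []       σ = σ , inj₁ refl , ≲-refl σ , λ ()
  least-below (τ ∷ xs) σ with τ ≲? σ
  ... | yes τ≲σ = let m , m∈ , m≲τ , least = least-below xs τ in
    m , inj₂ ([ here , there ]′ m∈) , ≲-trans m τ σ m≲τ τ≲σ ,
    λ { (here refl) _ → m≲τ ; (there p) → least p }
  ... | no τ≴σ = let m , m∈ , m≲σ , least = least-below xs σ in
    m , [ inj₁ , inj₂ ∘ there ]′ m∈ , m≲σ ,
    λ { {υ} (here refl) υ≲m → contradiction (≲-trans υ m σ υ≲m m≲σ) τ≴σ ; (there p) → least p }

  unifier? : ∀ Γ → Decidable (Unifier E Γ)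
  unifier? Γ σ = All.all? (λ (s , t) → ⊢-dec (s [ ⟦ σ ⟧ ]) (t [ ⟦ σ ⟧ ])) Γ

  unifier-upward : ∀ {Γ} σ τ → σ ≲ τ → Unifier E Γ σ → Unifier E Γ τ
  unifier-upward σ τ (λ′ , p) = All.map λ {(s , t)} q →
    transitive (symmetric (factor s)) (transitive (⊢-[] E ⟦ λ′ ⟧ q) (factor t))
    where
    factor : ∀ s → E ⊢ s [ ⟦ σ ⟧ ] [ ⟦ λ′ ⟧ ] ≈ s [ ⟦ τ ⟧ ]
    factor s = transitive (≡⇒⊢ E ([]-∘ s ⟦ σ ⟧ ⟦ λ′ ⟧)) ([]-⊢ E s λ _ → p _)

  IsMinimal : Problem Sg → Pred (Substitution Sg) 0ℓ
  IsMinimal Γ σ = ∀ τ → Unifier E Γ τ → τ ≲ σ → σ ≲ τ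

  minimal-below : ∀ Γ θ → Unifier E Γ θ → ∃[ m ] Unifier E Γ m × m ≲ θ × IsMinimal Γ m
  minimal-below Γ θ θ-unifies
    with ∃-below Γ | ∃-bounded θ
  ... | kΓ , Γ-below₀ | kθ , θ-bounded₀
    with least-below (filter (unifier? Γ) (candidates (kΓ ⊔ kθ))) θ
  ... | m , m∈ , m≲θ , least =
    m , [ (λ { refl → θ-unifies }) , (λ p → proj₂ (∈-filter⁻ (unifier? Γ) {xs = candidates k} p)) ]′ m∈ , m≲θ , minimal
    where
    k = kΓ ⊔ kθ
    θ-bounded : Bounded k θ
    θ-bounded = bounded-mono (m≤n⊔m kΓ kθ) θ-bounded₀
    Γ-below : All (λ (s , t) → Below k s × Below k t) Γ
    Γ-below = All.map
      (λ (a , b) → (λ v q → <-≤-trans (a v q) (m≤m⊔n kΓ kθ)) , (λ v q → <-≤-trans (b v q) (m≤m⊔n kΓ kθ)))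
      Γ-below₀

    minimal : IsMinimal Γ m
    -- Any competitor `τ` lies below `θ`, so it reduces to the first `k` variables and is
    -- represented there by a listed candidate `c`; from `c ≲ τ ≲ m` follows `m ≲ c ≲ τ`.
    minimal τ τ-unifies τ≲m = ≲-trans m c τ
      (least (∈-filter⁺ (unifier? Γ) c∈ (unifier-upward reduced c reduced≲c (reduced-unifier Γ-below τ-unifies)))
             (≲-trans c τ m c≲τ τ≲m))
      c≲τ
      where
      open Reduction θ τ θ-bounded (≲-trans τ m θ τ≲m m≲θ)
      approximation = candidates-complete reduced reduced-bounded
      c = proj₁ approximation
      c∈ = proj₁ (proj₂ approximation)
      reduced≲c = proj₂ (proj₂ (proj₂ approximation))
      c≲τ : c ≲ τ
      c≲τ = ≲-trans c reduced τ (proj₁ (proj₂ (proj₂ approximation))) reduced≲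

  ∼-trans : ∀ σ τ υ → σ ∼ τ → τ ∼ υ → σ ∼ υ
  ∼-trans σ τ υ (a , b) (c , d) = ≲-trans σ τ υ a c , ≲-trans υ τ σ d b

  ∼-sym : ∀ σ τ → σ ∼ τ → τ ∼ σ
  ∼-sym σ τ (a , b) = b , a

  stage : ℕ → List (Substitution Sg)
  stage zero    = candidates zero
  stage (suc k) = stage k ++ candidates (suc k)

  candidates⊆stage : ∀ k → candidates k ⊆ stage k
  candidates⊆stage zero    = id
  candidates⊆stage (suc k) = ∈-++⁺ʳ (stage k)

  FirstOfClass : Substitution Sg → List (Substitution Sg) → Set
  FirstOfClass σ = First (λ τ → ¬ τ ∼ σ) (σ ≡_)

  -- The candidates of all levels form one infinite list; a class is represented by its first member there.
  Representative : Pred (Substitution Sg) 0ℓ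
  Representative σ = ∃[ k ] FirstOfClass σ (stage k)

  -- Each stage is a prefix of the next, so later candidates cannot displace the first member of a
  -- class.
  stage-grows : ∀ {σ} d k → FirstOfClass σ (stage k) → FirstOfClass σ (stage (d + k))
  stage-grows zero    k p = p
  stage-grows (suc d) k p = ⁺++ (stage-grows d k p) _

  first-unique : ∀ {σ τ xs} → σ ∼ τ → FirstOfClass σ xs → FirstOfClass τ xs → σ ≡ τ
  first-unique σ∼τ (found refl) (found refl) = refl
  first-unique σ∼τ (found refl) (σ≁τ ∷ _)    = contradiction σ∼τ σ≁τ
  first-unique {σ} {τ} σ∼τ (τ≁σ ∷ _) (found refl) = contradiction (∼-sym σ τ σ∼τ) τ≁σ
  first-unique σ∼τ (_ ∷ p)      (_ ∷ q)      = first-unique σ∼τ p q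

  representative-unique : ∀ {σ τ} → σ ∼ τ → Representative σ → Representative τ → σ ≡ τ
  representative-unique {σ} {τ} σ∼τ (k , p) (l , q) = first-unique {σ} {τ} σ∼τ
    (subst (FirstOfClass σ ∘ stage) (+-comm l k) (stage-grows {σ} l k p)) (stage-grows {τ} k l q)

  ∃-first : ∀ σ xs → Any (_∼ σ) xs → ∃[ ρ ] ρ ∼ σ × FirstOfClass ρ xs
  ∃-first σ xs any = let ρ , ρ∼σ , p = go xs any in
    ρ , ρ∼σ , First.map (λ {τ} τ≁σ τ∼ρ → τ≁σ (∼-trans τ ρ σ τ∼ρ ρ∼σ)) id p
    where
    go : ∀ xs → Any (_∼ σ) xs → ∃[ ρ ] ρ ∼ σ × First (λ τ → ¬ τ ∼ σ) (ρ ≡_) xs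
    go (x ∷ xs) any with x ≲? σ ×-dec σ ≲? x
    ... | yes x∼σ = x , x∼σ , found refl
    go (x ∷ xs) (here x∼σ) | no x≁σ = contradiction x∼σ x≁σ
    go (x ∷ xs) (there any) | no x≁σ = let ρ , ρ∼σ , p = go xs any in ρ , ρ∼σ , x≁σ ∷ p

  ∃-representative : ∀ σ → ∃[ ρ ] ρ ∼ σ × Representative ρ
  ∃-representative σ =
    let k , b = ∃-bounded σ
        c , c∈ , c∼σ = candidates-complete σ b
        ρ , ρ∼σ , p = ∃-first σ (stage k) (lose (candidates⊆stage k c∈) c∼σ)
    in ρ , ρ∼σ , k , p

  MinimalUnifier : Problem Sg → Pred (Substitution Sg) 0ℓ
  MinimalUnifier Γ σ = Unifier E Γ σ × IsMinimal Γ σ × Representative σ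

  minimal-complete : ∀ Γ → MinimalComplete E Γ (MinimalUnifier Γ)
  minimal-complete Γ = record
    { unifiers = proj₁
    ; complete = λ θ θ-unifies →
        let m , m-unifies , m≲θ , m-minimal = minimal-below Γ θ θ-unifies
            ρ , (ρ≲m , m≲ρ) , ρ-rep = ∃-representative m
        in ρ ,
           ( unifier-upward m ρ m≲ρ m-unifies
           , (λ τ τ-unifies τ≲ρ →
               ≲-trans ρ m τ ρ≲m (m-minimal τ τ-unifies (≲-trans τ ρ m τ≲ρ ρ≲m)))
           , ρ-rep) ,
           ≲-trans ρ m θ ρ≲m m≲θ
    -- Minimality of `τ` turns `σ ≲ τ` into equivalence, and equivalent representatives are equal.
    ; minimal = λ σ τ (σ-unifies , _ , σ-rep) (_ , τ-minimal , τ-rep) σ≢τ σ≲τ →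
        σ≢τ (λ x → cong (λ υ → ⟦ υ ⟧ x)
          (representative-unique (σ≲τ , τ-minimal σ σ-unifies σ≲τ) σ-rep τ-rep))
    }

  -- Only type zero is worse than infinitary, and `minimal-complete` rules it out for every problem.
  worst-infinitary : ∀ Γ → Solvable E Γ → ∀ t → ProblemHasType E Γ t → t ≤ᵗ infinitary
  worst-infinitary Γ _ unitary    _ = z≤n
  worst-infinitary Γ _ finitary   _ = s≤s z≤n
  worst-infinitary Γ _ infinitary _ = ≤-refl
  worst-infinitary Γ _ zero       h = contradiction (MinimalUnifier Γ , minimal-complete Γ) h

-- Infinitely many minimal unifiers

bounded-resp : ∀ {Sg k} {σ τ : Substitution Sg} → σ ≐ τ → Bounded k σ → Bounded k τ
bounded-resp e b .fixes {x} k≤x     = trans (sym (e x)) (b .fixes k≤x)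
bounded-resp e b .below {x} x<k v p = b .below x<k v (subst (λ t → v ∈ vars t) (sym (e x)) p)

∃-common-bound : ∀ {Sg} n (σ : Fin n → Substitution Sg) → ∃[ k ] (∀ i → Bounded k (σ i))
∃-common-bound zero    σ = 0 , λ ()
∃-common-bound (suc n) σ =
  let k , b = ∃-bounded (σ zero) ; l , bs = ∃-common-bound n (σ ∘ suc) in
  k ⊔ l , λ { zero → bounded-mono (m≤m⊔n k l) b ; (suc i) → bounded-mono (m≤n⊔m k l) (bs i) }

-- What the three theories share: regularity, decidability, and equality of terms whose variable
-- words agree in the free idempotent monoid. `unword` inverts `vars` only on words equivalent to
-- that of a term, since without a constant no term has the empty word.
module RegularBand {Sg : Signature} (E : Theory Sg)
  (regular : ∀ {s t} → E ⊢ s ≈ t → vars s ⊆ vars t)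
  (⊢-dec : ∀ s t → Dec (E ⊢ s ≈ t))
  (≈ʷ⇒⊢ : ∀ s t → vars s ≈ʷ vars t → E ⊢ s ≈ t)
  (unword : Word → Term Sg)
  (vars-unword : ∀ (t : Term Sg) {r} → vars t ≈ʷ r → vars (unword r) ≡ r)
  (f : Term Sg → Term Sg → Term Sg)
  (vars-f : ∀ s t → vars (f s t) ≡ vars s ++ vars t)
  (f-[] : ∀ s t (σ : Map Sg) → f s t [ σ ] ≡ f (s [ σ ]) (t [ σ ])) where

  reps : ℕ → List (Term Sg)
  reps k = List.map unword (wordReps (upTo k) k)

  reps-complete : ∀ k t → Below k t → ∃[ r ] r ∈ reps k × E ⊢ r ≈ t
  reps-complete k t t<k =
    let t⊆ : vars t ⊆ upTo k
        t⊆ v∈ = ∈-upTo⁺ (t<k _ v∈)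
        r , r∈ , p = wordReps-complete k (upTo k) t⊆ t⊆ (≤-reflexive (length-upTo k))
    in unword r , ∈-map⁺ unword r∈ , ≈ʷ⇒⊢ (unword r) t (transʷ (≡⇒≈ʷ (vars-unword t p)) (symʷ p))

  open Regular E regular
  open LocallyFinite E regular ⊢-dec reps reps-complete

  -- The word `xyx`. Under commutativity it is just the join of `x` and `y`, while the two outer
  -- copies of `x` make room for `drop-middle` without commutativity.
  sandwich : V → Term Sg
  sandwich y = f (var 0) (f (var y) (var 0))

  sandwich-[] : ∀ y σ → sandwich y [ σ ] ≡ f (σ 0) (f (σ y) (σ 0))
  sandwich-[] y σ = trans (f-[] _ _ σ) (cong (f (σ 0)) (f-[] _ _ σ))

  vars-sandwich : ∀ y σ → vars (sandwich y [ σ ]) ≡ vars (σ 0) ++ vars (σ y) ++ vars (σ 0)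
  vars-sandwich y σ = trans (cong vars (sandwich-[] y σ))
    (trans (vars-f (σ 0) _) (cong (vars (σ 0) ++_) (vars-f (σ y) (σ 0))))

  Γ : Problem Sg
  Γ = (sandwich 1 , sandwich 2) ∷ []

  -- With x = x₀, y = x₁, z = x₂ in place of 0, 1, 2, the Boolean solutions of x ∨ y = x ∨ z have the four
  -- irreducible elements {x}, {x,z}, {x,y} and {y,z}; they are the columns of the letters 0, 1, 2 and 3.
  -- The fourth letter shifts all remaining variables, so that k + 1 letters occur in the images of k variables.
  θ-map : Map Sg
  θ-map 0 = f (var 0) (f (var 1) (var 2))
  θ-map 1 = f (var 3) (f (var 2) (var 3))
  θ-map 2 = f (var 3) (f (var 1) (var 3))
  θ-map (suc (suc (suc i))) = var (4 + i)

  letters : V → Word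
  letters 0 = 0 ∷ 1 ∷ 2 ∷ []
  letters 1 = 3 ∷ 2 ∷ 3 ∷ []
  letters 2 = 3 ∷ 1 ∷ 3 ∷ []
  letters (suc (suc (suc i))) = 4 + i ∷ []

  vars-f-f : ∀ x y z → vars (f (var x) (f (var y) (var z))) ≡ x ∷ y ∷ z ∷ []
  vars-f-f x y z = trans (vars-f _ _) (cong (x ∷_) (vars-f _ _))

  vars-θ : ∀ x → vars (θ-map x) ≡ letters x
  vars-θ 0 = vars-f-f 0 1 2
  vars-θ 1 = vars-f-f 3 2 3
  vars-θ 2 = vars-f-f 3 1 3
  vars-θ (suc (suc (suc i))) = refl

  θ : ℕ → Substitution Sg
  θ k = cut k θ-map

  vars-θ-< : ∀ {k x} → x < k → vars (⟦ θ k ⟧ x) ≡ letters x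
  vars-θ-< {k} {x} x<k = trans (cong vars (cutMap-< θ-map x<k)) (vars-θ x)

  decided-⊆ : ∀ u v {_ : True (All.all? (_∈? v) u)} → u ⊆ v
  decided-⊆ u v {p} = All.lookup (toWitness p)

  decided-∉ : ∀ {x u} {_ : False (x ∈? u)} → x ∉ u
  decided-∉ {_} {_} {p} = toWitnessFalse p

  -- Both words have the form `X ++ c ∷ Y` with a single middle letter `c`, 2 or 1. As `X` and `Y`
  -- contain the same four letters, `drop-middle` removes it.
  words-agree : letters 0 ++ letters 1 ++ letters 0 ≈ʷ letters 0 ++ letters 2 ++ letters 0
  words-agree = transʷ (shorten 2) (symʷ (shorten 1))
    where
    X Y : Word
    X = 0 ∷ 1 ∷ 2 ∷ 3 ∷ []
    Y = 3 ∷ 0 ∷ 1 ∷ 2 ∷ []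
    shorten : ∀ c {_ : True (All.all? (_∈? Y) (X ++ c ∷ []))} → X ++ (c ∷ []) ++ Y ≈ʷ X ++ Y
    shorten c {p} = drop-middle {X} {c ∷ []} {Y} (decided-⊆ Y X) (All.lookup (toWitness p))

  θ-unifies : ∀ {k} → 3 ≤ k → Unifier E Γ (θ k)
  θ-unifies {k} 3≤k = ≈ʷ⇒⊢ _ _ (subst₂ _≈ʷ_ (sym (word 1 (s≤s (s≤s z≤n)))) (sym (word 2 ≤-refl)) words-agree) ∷ []
    where
    word : ∀ y → y < 3 → vars (sandwich y [ ⟦ θ k ⟧ ]) ≡ letters 0 ++ letters y ++ letters 0
    word y y<3 = trans (vars-sandwich y ⟦ θ k ⟧)
      (cong₂ _++_ e (cong₂ _++_ (vars-θ-< (<-≤-trans y<3 3≤k)) e))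
      where
      e : vars (⟦ θ k ⟧ 0) ≡ letters 0
      e = vars-θ-< (<-≤-trans (s≤s z≤n) 3≤k)

  -- A variable whose image contains the given letter, chosen so that only the letters 2 and 3 can
  -- be confused in `separated`.
  home : V → V
  home 0 = 0
  home 1 = 2
  home 2 = 1
  home 3 = 1
  home (suc (suc (suc (suc i)))) = 3 + i

  home-∋ : ∀ v → v ∈ letters (home v)
  home-∋ 0 = here refl
  home-∋ 1 = there (here refl)
  home-∋ 2 = there (here refl)
  home-∋ 3 = here refl
  home-∋ (suc (suc (suc (suc i)))) = here refl

  home-< : ∀ {k v} → 3 ≤ k → v ≤ k → home v < k
  home-< {v = 0} 3≤k _ = <-≤-trans (s≤s z≤n) 3≤k
  home-< {v = 1} 3≤k _ = 3≤k
  home-< {v = 2} 3≤k _ = <-≤-trans (s≤s (s≤s z≤n)) 3≤k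
  home-< {v = 3} 3≤k _ = <-≤-trans (s≤s (s≤s z≤n)) 3≤k
  -- Letter `4 + i` is the image of variable `3 + i`; this shift by one makes `v ≤ k` literally the
  -- claim.
  home-< {v = suc (suc (suc (suc i)))} _ v≤k = v≤k

  separated : ∀ a b → a ∈ letters (home b) → b ∈ letters (home a) → a ≡ b ⊎ (a ≡ 2 × b ≡ 3 ⊎ a ≡ 3 × b ≡ 2)
  separated _ 0 (here refl)                 q = inj₁ refl
  separated _ 0 (there (here refl))         q = contradiction q decided-∉
  separated _ 0 (there (there (here refl))) q = contradiction q decided-∉
  separated _ 1 (here refl)                 q = contradiction q decided-∉
  separated _ 1 (there (here refl))         q = inj₁ refl
  separated _ 1 (there (there (here refl))) q = contradiction q decided-∉
  separated _ 2 (here refl)                 q = inj₂ (inj₂ (refl , refl))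
  separated _ 2 (there (here refl))         q = inj₁ refl
  separated _ 2 (there (there (here refl))) q = inj₂ (inj₂ (refl , refl))
  separated _ 3 (here refl)                 q = inj₁ refl
  separated _ 3 (there (here refl))         q = inj₂ (inj₁ (refl , refl))
  separated _ 3 (there (there (here refl))) q = inj₁ refl
  separated _ (suc (suc (suc (suc i)))) (here refl) q = inj₁ refl

  -- Each of the k + 1 letters would need its own variable below k.
  θ-uncovered : ∀ {k} σ → 3 ≤ k → Bounded k σ → Unifier E Γ σ → ¬ σ ≲ θ k
  θ-uncovered {k} σ 3≤k σ-bounded (σ-unifies ∷ []) σ≲θ = 1+n≰n (injective⇒≤ {f = source} source-injective)
    where
    λ′ = proj₁ σ≲θ

    spread : ∀ {x y v} → x < k → y ∈ vars (⟦ σ ⟧ x) → v ∈ vars (⟦ λ′ ⟧ y) → v ∈ letters x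
    spread {x} x<k y∈ v∈ = subst (_ ∈_) (vars-θ-< x<k) (instance-vars σ (θ k) σ≲θ x y∈ v∈)

    Source : V → V → Set
    Source v y = y ∈ vars (⟦ σ ⟧ (home v)) × v ∈ vars (⟦ λ′ ⟧ y)

    ∃-source : ∀ {v} → v ≤ k → ∃ (Source v)
    ∃-source {v} v≤k = instance-vars⁻ σ (θ k) σ≲θ (home v)
      (subst (v ∈_) (sym (vars-θ-< (home-< 3≤k v≤k))) (home-∋ v))

    bound : (i : Fin (suc k)) → toℕ i ≤ k
    bound i = ≤-pred (toℕ<n i)

    source : Fin (suc k) → Fin k
    source i = fromℕ< (σ-bounded .below (home-< 3≤k (bound i)) _ (proj₁ (proj₂ (∃-source (bound i)))))

    -- The equation enters here. A common source occurs in `⟦ σ ⟧ 1`, hence by regularity in the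
    -- instance of `sandwich 2`, that is, in `⟦ σ ⟧ 0` or `⟦ σ ⟧ 2`. But the images of 0 and 2 under
    -- `θ k` lack the letters 3 and 2 respectively.
    absurd-2-3 : ∀ {y} → Source 2 y → Source 3 y → ⊥
    absurd-2-3 {y} (y∈ , 2∈) (_ , 3∈)
      with ∈-++⁻ (vars (⟦ σ ⟧ 0)) (subst (y ∈_) (vars-sandwich 2 ⟦ σ ⟧)
             (regular σ-unifies (subst (y ∈_) (sym (vars-sandwich 1 ⟦ σ ⟧)) (∈-++⁺ʳ (vars (⟦ σ ⟧ 0)) (∈-++⁺ˡ y∈)))))
    ... | inj₁ p = decided-∉ (spread (<-≤-trans (s≤s z≤n) 3≤k) p 3∈)
    ... | inj₂ p with ∈-++⁻ (vars (⟦ σ ⟧ 2)) p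
    ...   | inj₁ q = decided-∉ (spread 3≤k q 2∈)
    ...   | inj₂ q = decided-∉ (spread (<-≤-trans (s≤s z≤n) 3≤k) q 3∈)

    same-source : ∀ {a b y} → a ≤ k → b ≤ k → Source a y → Source b y → a ≡ b
    same-source {a} {b} a≤k b≤k sa@(y∈a , a∈) sb@(y∈b , b∈)
      with separated a b (spread (home-< 3≤k b≤k) y∈b a∈) (spread (home-< 3≤k a≤k) y∈a b∈)
    ... | inj₁ e                    = e
    ... | inj₂ (inj₁ (refl , refl)) = ⊥-elim (absurd-2-3 sa sb)
    ... | inj₂ (inj₂ (refl , refl)) = ⊥-elim (absurd-2-3 sb sa)

    source-injective : ∀ {i j} → source i ≡ source j → i ≡ j
    source-injective {i} {j} e = toℕ-injective (same-source (bound i) (bound j)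
      (proj₂ (∃-source (bound i)))
      (subst (Source (toℕ j)) (sym (fromℕ<-injective _ _ _ _ e)) (proj₂ (∃-source (bound j)))))

  infinite : Infinite (MinimalUnifier Γ)
  infinite (n , bijection) =
    let k , b = ∃-common-bound n (proj₁ ∘ Bijection.to bijection)
        σ , σ∈ , σ≲θ = MinimalComplete.complete (minimal-complete Γ) (θ (3 ⊔ k)) (θ-unifies (m≤m⊔n 3 k))
        i , to-i = Bijection.surjective bijection (σ , σ∈)
    -- Surjectivity yields a listed map that agrees with `σ` pointwise, so the common bound carries
    -- over to `σ`.
    in θ-uncovered σ (m≤m⊔n 3 k) (bounded-mono (m≤n⊔m 3 k) (bounded-resp (to-i refl) (b i))) (proj₁ σ∈) σ≲θ

  has-type-infinitary : HasUnrestrictedType E infinitary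
  has-type-infinitary = record
    { attained = Γ , (θ 3 , θ-unifies ≤-refl) , MinimalUnifier Γ , minimal-complete Γ , infinite
    ; worst    = worst-infinitary
    }

-- Interpretations of words

module Valuation (M : IdempotentMonoid 0ℓ 0ℓ) (ρ : V → IdempotentMonoid.Carrier M) where
  open IdempotentMonoid M renaming (refl to ≈-refl; sym to ≈-sym; trans to ≈-trans; idem to ∙-idem)

  ⟦_⟧ʷ : Word → Carrier
  ⟦ []    ⟧ʷ = ε
  ⟦ x ∷ u ⟧ʷ = ρ x ∙ ⟦ u ⟧ʷ

  homo : ∀ u v → ⟦ u ++ v ⟧ʷ ≈ ⟦ u ⟧ʷ ∙ ⟦ v ⟧ʷ
  homo []      v = ≈-sym (identityˡ _)
  homo (x ∷ u) v = ≈-trans (∙-cong ≈-refl (homo u v)) (≈-sym (assoc _ _ _))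

  ≈ʷ-valid : ∀ {u v} → u ≈ʷ v → ⟦ u ⟧ʷ ≈ ⟦ v ⟧ʷ
  ≈ʷ-valid (idem u)     = ≈-trans (homo u u) (∙-idem _)
  ≈ʷ-valid reflʷ        = ≈-refl
  ≈ʷ-valid (symʷ p)     = ≈-sym (≈ʷ-valid p)
  ≈ʷ-valid (transʷ p q) = ≈-trans (≈ʷ-valid p) (≈ʷ-valid q)
  ≈ʷ-valid (++-cong {u} {u′} {v} {v′} p q) =
    ≈-trans (homo u v) (≈-trans (∙-cong (≈ʷ-valid p) (≈ʷ-valid q)) (≈-sym (homo u′ v′)))

  module _ (comm : ∀ x y → x ∙ y ≈ y ∙ x) where

    letter-absorbed : ∀ {x u} → x ∈ u → ρ x ∙ ⟦ u ⟧ʷ ≈ ⟦ u ⟧ʷ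
    letter-absorbed (here refl) = ≈-trans (≈-sym (assoc _ _ _)) (∙-cong (∙-idem _) ≈-refl)
    letter-absorbed {x} {y ∷ u} (there p) =
      ≈-trans (≈-sym (assoc _ _ _)) (≈-trans (∙-cong (comm _ _) ≈-refl)
        (≈-trans (assoc _ _ _) (∙-cong ≈-refl (letter-absorbed p))))

    ⊆-absorbed : ∀ {u v} → u ⊆ v → ⟦ u ⟧ʷ ∙ ⟦ v ⟧ʷ ≈ ⟦ v ⟧ʷ
    ⊆-absorbed {[]}    s = identityˡ _
    ⊆-absorbed {x ∷ u} s =
      ≈-trans (assoc _ _ _) (≈-trans (∙-cong ≈-refl (⊆-absorbed (s ∘ there))) (letter-absorbed (s (here refl))))

    -- Each word absorbs the other: `u` equals `vu`, which is `uv` by commutativity, which is `v`.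
    ⊆×⊇-valid : ∀ {u v} → u ⊆ v → v ⊆ u → ⟦ u ⟧ʷ ≈ ⟦ v ⟧ʷ
    ⊆×⊇-valid u⊆v v⊆u = ≈-trans (≈-sym (⊆-absorbed v⊆u)) (≈-trans (comm _ _) (⊆-absorbed u⊆v))

-- A term denotes the product of its variables. The map `ι` into the monoid is `id` when the theory
-- has a unit and `just` when a unit is adjoined.
module TermValuation {Sg : Signature} (M : IdempotentMonoid 0ℓ 0ℓ) (ι : Term Sg → IdempotentMonoid.Carrier M) where
  open IdempotentMonoid M renaming (refl to ≈-refl; sym to ≈-sym; trans to ≈-trans) hiding (idem)
  open Valuation M (ι ∘ var) public

  product : ∀ {n} → Vec (Term Sg) n → Carrier
  product []       = ε
  product (t ∷ ts) = ι t ∙ product ts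

  module _ (ι-op : ∀ g ts → ι (op g ts) ≈ product ts) where
    mutual
      ι-vars : ∀ t → ι t ≈ ⟦ vars t ⟧ʷ
      ι-vars (var x)   = ≈-sym (identityʳ _)
      ι-vars (op g ts) = ≈-trans (ι-op g ts) (product-vars ts)

      product-vars : ∀ {n} (ts : Vec (Term Sg) n) → product ts ≈ ⟦ vars* ts ⟧ʷ
      product-vars []       = ≈-refl
      product-vars (t ∷ ts) = ≈-trans (∙-cong (ι-vars t) (product-vars ts)) (≈-sym (homo (vars t) (vars* ts)))

-- Soundness half of the word problems: words modulo `_≋_` form an algebra in which every symbol
-- concatenates its arguments, and evaluation at one-letter words returns `vars`.
module WordModel (Sg : Signature) {_≋_ : Word → Word → Set} (≋-isEquivalence : IsEquivalence _≋_)
  (≋-++ : ∀ {u u′ v v′} → u ≋ u′ → v ≋ v′ → (u ++ v) ≋ (u′ ++ v′)) where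

  open IsEquivalence ≋-isEquivalence using () renaming (refl to ≋-refl)

  concatenate : ∀ {n} → Vec Word n → Word
  concatenate []       = []
  concatenate (u ∷ us) = u ++ concatenate us

  concatenate-cong : ∀ {n} {us vs : Vec Word n} → Pointwise _≋_ us vs → concatenate us ≋ concatenate vs
  concatenate-cong []       = ≋-refl
  concatenate-cong (p ∷ ps) = ≋-++ p (concatenate-cong ps)

  wordAlgebra : Algebra Sg 0ℓ 0ℓ
  wordAlgebra = record
    { carrier    = record { isEquivalence = ≋-isEquivalence }
    ; apply      = λ _ → concatenate
    ; apply-cong = λ _ → concatenate-cong
    }

  open Algebra wordAlgebra using (eval; eval*; IsModelOf)

  mutual
    eval-vars : ∀ t → eval (_∷ []) t ≡ vars t
    eval-vars (var x)   = refl
    eval-vars (op g ts) = eval*-vars ts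

    eval*-vars : ∀ {n} (ts : Vec (Term Sg) n) → concatenate (eval* (_∷ []) ts) ≡ vars* ts
    eval*-vars []       = refl
    eval*-vars (t ∷ ts) = cong₂ _++_ (eval-vars t) (eval*-vars ts)

  ⊢⇒≋ : ∀ {E} → IsModelOf E → ∀ {s t} → E ⊢ s ≈ t → vars s ≋ vars t
  ⊢⇒≋ {E} model {s} {t} p = subst₂ _≋_ (eval-vars s) (eval-vars t) (soundness E wordAlgebra model p (_∷ []))

≈ʷ-isEquivalence : IsEquivalence _≈ʷ_
≈ʷ-isEquivalence = record { refl = reflʷ ; sym = symʷ ; trans = transʷ }

infix 4 _≈ˢ_
_≈ˢ_ : Word → Word → Set
u ≈ˢ v = u ⊆ v × v ⊆ u

≈ˢ-isEquivalence : IsEquivalence _≈ˢ_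
≈ˢ-isEquivalence = record
  { refl  = id , id
  ; sym   = λ (a , b) → b , a
  ; trans = λ (a , b) (c , d) → c ∘ a , b ∘ d
  }

≈ˢ-++ : ∀ {u u′ v v′} → u ≈ˢ u′ → v ≈ˢ v′ → u ++ v ≈ˢ u′ ++ v′
≈ˢ-++ (a , b) (c , d) = ++⁺ a c , ++⁺ b d

infix 4 _≈ˢ?_
_≈ˢ?_ : ∀ u v → Dec (u ≈ˢ v)
u ≈ˢ? v = map′ (λ (a , b) → All.lookup a , All.lookup b) (λ (a , b) → All.tabulate a , All.tabulate b)
  (All.all? (_∈? v) u ×-dec All.all? (_∈? u) v)

A-valid : ∀ u v w → u ++ (v ++ w ++ []) ++ [] ≡ (u ++ v ++ []) ++ w ++ []
A-valid u v w = solve (++-monoid V)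

C-valid : ∀ u v → u ++ v ++ [] ≈ˢ v ++ u ++ []
C-valid u v = swap u v , swap v u
  where
  swap : ∀ u v → u ++ v ++ [] ⊆ v ++ u ++ []
  swap u v p with ∈-++⁻ u p
  ... | inj₁ q = ∈-++⁺ʳ v (∈-++⁺ˡ q)
  ... | inj₂ q = ∈-++⁺ˡ (subst (_ ∈_) (++-identityʳ v) q)

I-valid : ∀ u → u ++ u ++ [] ≈ʷ u
I-valid u = transʷ (≡⇒≈ʷ (cong (u ++_) (++-identityʳ u))) (idem u)

-- The three theories

module Bands where
  f : Term sig-f → Term sig-f → Term sig-f
  f s t = op zero (s ∷ t ∷ [])

  vars-f : ∀ s t → vars (f s t) ≡ vars s ++ vars t
  vars-f s t = cong (vars s ++_) (++-identityʳ (vars t))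

  ∃-vars : ∀ (t : Term sig-f) → ∃[ x ] x ∈ vars t
  ∃-vars (var x)              = x , here refl
  ∃-vars (op zero (t ∷ _ ∷ [])) = let x , p = ∃-vars t in x , ∈-++⁺ˡ p

  unword : Word → Term sig-f
  unword []          = var 0
  unword (x ∷ [])    = var x
  unword (x ∷ y ∷ u) = f (var x) (unword (y ∷ u))

  vars-unword⁺ : ∀ x u → vars {sig-f} (unword (x ∷ u)) ≡ x ∷ u
  vars-unword⁺ x []      = refl
  vars-unword⁺ x (y ∷ u) = cong (x ∷_) (trans (++-identityʳ _) (vars-unword⁺ y u))

  -- A term without constants has at least one variable, so the arbitrary value of `unword` at the
  -- empty word never matters.
  vars-unword : ∀ (t : Term sig-f) {r} → vars t ≈ʷ r → vars (unword r) ≡ r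
  vars-unword t {[]}    p = contradiction (≈ʷ⇒⊆ p (proj₂ (∃-vars t))) λ ()
  vars-unword t {x ∷ u} p = vars-unword⁺ x u

  -- The term algebra has no unit, so one is adjoined to interpret the empty word.
  open Identities f

  module _ (E : Theory sig-f) (A⊆E : ∀ {p} → A p → E p) (I⊆E : ∀ {p} → I p → E p) where

    substitute : Term sig-f → Term sig-f → Term sig-f → Map sig-f
    substitute s t u 0 = s
    substitute s t u 1 = t
    substitute s t u _ = u

    monoid : IdempotentMonoid 0ℓ 0ℓ
    monoid = record
      { isIdempotentMonoid = record
        { isMonoid = isMonoid (record
          { isMagma = record
            { isEquivalence = Algebra.isEquivalence (termAlgebra E)
            ; ∙-cong        = λ p q → congruent zero (p ∷ q ∷ [])
            }
          ; assoc = λ s t u → symmetric (instance-of (A⊆E refl) (substitute s t u))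
          })
        ; idem = λ { nothing → ∙≈∙ ; (just t) → [ instance-of (I⊆E refl) (λ _ → t) ]≈ }
        }
      }

    open TermValuation monoid just public

    ι-op : ∀ g ts → IdempotentMonoid._≈_ monoid (just (op g ts)) (product ts)
    ι-op zero (s ∷ t ∷ []) = [ reflexive ]≈

    reflects : ∀ {s t} → IdempotentMonoid._≈_ monoid ⟦ vars s ⟧ʷ ⟦ vars t ⟧ʷ → E ⊢ s ≈ t
    reflects {s} {t} p with ≈-trans (ι-vars ι-op s) (≈-trans p (≈-sym (ι-vars ι-op t)))
      where open IdempotentMonoid monoid using () renaming (trans to ≈-trans; sym to ≈-sym)
    ... | [ q ]≈ = q

    ≈ʷ⇒⊢ : ∀ s t → vars s ≈ʷ vars t → E ⊢ s ≈ t
    ≈ʷ⇒⊢ s t = reflects ∘ ≈ʷ-valid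

    module _ (C⊆E : ∀ {p} → C p → E p) where

      ≈ˢ⇒⊢ : ∀ {s t} → vars s ≈ˢ vars t → E ⊢ s ≈ t
      ≈ˢ⇒⊢ (p , q) = reflects (⊆×⊇-valid commutative p q)
        where
        open IdempotentMonoid monoid using (_≈_) renaming (_∙_ to _·_; refl to ≈-refl)
        commutative : ∀ x y → x · y ≈ y · x
        commutative nothing  nothing  = ∙≈∙
        commutative nothing  (just _) = ≈-refl
        commutative (just _) nothing  = ≈-refl
        commutative (just s) (just t) = [ instance-of (C⊆E refl) (substitute s t t) ]≈

  AI-model : Algebra.IsModelOf (WordModel.wordAlgebra sig-f ≈ʷ-isEquivalence ++-cong) AI
  AI-model (inj₁ refl) ρ = ≡⇒≈ʷ (A-valid (ρ 0) (ρ 1) (ρ 2))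
  AI-model (inj₂ refl) ρ = I-valid (ρ 0)

  AI⊢⇒≈ʷ : ∀ {s t} → AI ⊢ s ≈ t → vars s ≈ʷ vars t
  AI⊢⇒≈ʷ = WordModel.⊢⇒≋ sig-f ≈ʷ-isEquivalence ++-cong AI-model

  AI-infinitary : HasUnrestrictedType AI infinitary
  AI-infinitary = RegularBand.has-type-infinitary AI (λ p → ≈ʷ⇒⊆ (AI⊢⇒≈ʷ p))
    (λ s t → map′ (complete s t) AI⊢⇒≈ʷ (vars s ≈ʷ? vars t)) complete
    unword vars-unword f vars-f (λ _ _ _ → refl)
    where
    complete : ∀ s t → vars s ≈ʷ vars t → AI ⊢ s ≈ t
    complete = ≈ʷ⇒⊢ AI inj₁ inj₂

  ACI-model : Algebra.IsModelOf (WordModel.wordAlgebra sig-f ≈ˢ-isEquivalence ≈ˢ-++) ACI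
  ACI-model (inj₁ refl)        ρ = ≈ʷ⇒⊆×⊇ (≡⇒≈ʷ (A-valid (ρ 0) (ρ 1) (ρ 2)))
  ACI-model (inj₂ (inj₁ refl)) ρ = C-valid (ρ 0) (ρ 1)
  ACI-model (inj₂ (inj₂ refl)) ρ = ≈ʷ⇒⊆×⊇ (I-valid (ρ 0))

  ACI⊢⇒≈ˢ : ∀ {s t} → ACI ⊢ s ≈ t → vars s ≈ˢ vars t
  ACI⊢⇒≈ˢ = WordModel.⊢⇒≋ sig-f ≈ˢ-isEquivalence ≈ˢ-++ ACI-model

  ACI-infinitary : HasUnrestrictedType ACI infinitary
  ACI-infinitary = RegularBand.has-type-infinitary ACI (λ p → proj₁ (ACI⊢⇒≈ˢ p))
    (λ s t → map′ (≈ˢ⇒⊢ ACI inj₁ (inj₂ ∘ inj₂) (inj₂ ∘ inj₁)) ACI⊢⇒≈ˢ (vars s ≈ˢ? vars t))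
    (≈ʷ⇒⊢ ACI inj₁ (inj₂ ∘ inj₂))
    unword vars-unword f vars-f (λ _ _ _ → refl)

module UnitalBands where
  f : Term sig-f0 → Term sig-f0 → Term sig-f0
  f s t = op zero (s ∷ t ∷ [])

  𝟘 : Term sig-f0
  𝟘 = op (suc zero) []

  vars-f : ∀ s t → vars (f s t) ≡ vars s ++ vars t
  vars-f s t = cong (vars s ++_) (++-identityʳ (vars t))

  unword : Word → Term sig-f0
  unword []      = 𝟘
  unword (x ∷ u) = f (var x) (unword u)

  vars-unword : ∀ u → vars (unword u) ≡ u
  vars-unword []      = refl
  vars-unword (x ∷ u) = cong (x ∷_) (trans (++-identityʳ _) (vars-unword u))

  substitute : Term sig-f0 → Term sig-f0 → Term sig-f0 → Map sig-f0
  substitute s t u 0 = s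
  substitute s t u 1 = t
  substitute s t u _ = u

  f-comm : ∀ s t → ACUI ⊢ f s t ≈ f t s
  f-comm s t = instance-of (inj₂ (inj₁ refl)) (substitute s t t)

  f-unit : ∀ s → ACUI ⊢ f s 𝟘 ≈ s
  f-unit s = instance-of (inj₂ (inj₂ (inj₁ refl))) (λ _ → s)

  monoid : IdempotentMonoid 0ℓ 0ℓ
  monoid = record
    { isIdempotentMonoid = record
      { isMonoid = record
        { isSemigroup = record
          { isMagma = record
            { isEquivalence = Algebra.isEquivalence (termAlgebra ACUI)
            ; ∙-cong        = λ p q → congruent zero (p ∷ q ∷ [])
            }
          ; assoc = λ s t u → symmetric (instance-of (inj₁ refl) (substitute s t u))
          }
        -- Only the right unit law is an axiom; the left one comes from commutativity.
        ; identity = (λ s → transitive (f-comm 𝟘 s) (f-unit s)) , f-unit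
        }
      ; idem = λ t → instance-of (inj₂ (inj₂ (inj₂ refl))) (λ _ → t)
      }
    }

  open TermValuation monoid id

  ι-op : ∀ g ts → ACUI ⊢ op g ts ≈ product ts
  ι-op zero       (s ∷ t ∷ []) = congruent zero (reflexive ∷ symmetric (f-unit t) ∷ [])
  ι-op (suc zero) []           = reflexive

  reflects : ∀ s t → ACUI ⊢ ⟦ vars s ⟧ʷ ≈ ⟦ vars t ⟧ʷ → ACUI ⊢ s ≈ t
  reflects s t p = transitive (ι-vars ι-op s) (transitive p (symmetric (ι-vars ι-op t)))

  ACUI-model : Algebra.IsModelOf (WordModel.wordAlgebra sig-f0 ≈ˢ-isEquivalence ≈ˢ-++) ACUI
  ACUI-model (inj₁ refl)               ρ = ≈ʷ⇒⊆×⊇ (≡⇒≈ʷ (A-valid (ρ 0) (ρ 1) (ρ 2)))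
  ACUI-model (inj₂ (inj₁ refl))        ρ = C-valid (ρ 0) (ρ 1)
  ACUI-model (inj₂ (inj₂ (inj₁ refl))) ρ = ≈ʷ⇒⊆×⊇ (≡⇒≈ʷ (++-identityʳ (ρ 0)))
  ACUI-model (inj₂ (inj₂ (inj₂ refl))) ρ = ≈ʷ⇒⊆×⊇ (I-valid (ρ 0))

  ACUI⊢⇒≈ˢ : ∀ {s t} → ACUI ⊢ s ≈ t → vars s ≈ˢ vars t
  ACUI⊢⇒≈ˢ = WordModel.⊢⇒≋ sig-f0 ≈ˢ-isEquivalence ≈ˢ-++ ACUI-model

  ACUI-infinitary : HasUnrestrictedType ACUI infinitary
  ACUI-infinitary = RegularBand.has-type-infinitary ACUI (λ p → proj₁ (ACUI⊢⇒≈ˢ p))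
    (λ s t → map′ (λ (p , q) → reflects s t (⊆×⊇-valid f-comm p q)) ACUI⊢⇒≈ˢ (vars s ≈ˢ? vars t))
    (λ s t → reflects s t ∘ ≈ʷ-valid)
    unword (λ _ {r} _ → vars-unword r) f vars-f (λ _ _ _ → refl)

AI-elementary : Elementary AI
AI-elementary zero = _ , _ , inj₂ refl , inj₁ root

ACI-elementary : Elementary ACI
ACI-elementary zero = _ , _ , inj₂ (inj₂ refl) , inj₁ root

ACUI-elementary : Elementary ACUI
ACUI-elementary zero       = _ , _ , inj₂ (inj₂ (inj₂ refl)) , inj₁ root
ACUI-elementary (suc zero) = _ , _ , inj₂ (inj₂ (inj₁ refl)) , inj₁ (inside (VecAny.there (VecAny.here root)))

theorem6p13 : HasElementaryUnrestrictedType AI infinitary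
    × HasElementaryUnrestrictedType ACI infinitary
    × HasElementaryUnrestrictedType ACUI infinitary
theorem6p13 =
  (AI-elementary , Bands.AI-infinitary) ,
  (ACI-elementary , Bands.ACI-infinitary) ,
  (ACUI-elementary , UnitalBands.ACUI-infinitary)
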